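{- Let $G$ be a graph on $n$ vertices, $k$ a positive integer and $\mathcal{F}$ a layered family of $G$ with thickness at most $k$, with set of centers $\mathcal{C}_{\mathcal{F}}$. Then for every $X\subseteq\mathcal{C}_{\mathcal{F}}$ there exists an $(X,\frac{95}{100})$-balanced separator $S$ in $G$ such that $S$ is downward closed and $\mathrm{fcov}_{\mathcal{F}}(S)\le 5000k\cdot\log 2n\cdot\log(f+4)\cdot f$, where $f$ is the optimum value of the following linear program in nonnegative variables $x_F$ ($F\in\mathcal{F}$) and $d_{u,v}$ ($u,v\in X$): minimize $\sum_{F\in\mathcal{F}}x_F$ subject to $\sum_{v\in X}d_{u,v}\ge |X|/10$ for all $u\in X$; $d_{u,v}\le\sum_{F\in\mathcal{F},\,F\cap P\ne\emptyset}x_F$ for all $u,v\in X$ and every induced $u$--$v$ path $P$ in $G$; and $d_{u,v}\le 1$ for all $u,v\in X$.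
   Context: Logarithms are base 2. Layered family: given an ordered partition $\Pi=(L_1,\dots,L_m)$ of $V(G)$, the layer digraph has an arc $(u,v)$ iff $uv\in E(G)$, $u\in L_i$, $v\in L_j$, $j<i$. $v$ is a descendant of $u$ (and $u$ an ancestor of $v$) if there is a directed path from $u$ to $v$ (including $v=u$). For each vertex $u$ with no in-arcs, the set of $u$ and all its descendants is in $\mathcal{F}$, with center $u$; $\mathcal{C}_{\mathcal{F}}$ is the set of centers. Thickness: smallest $k$ with every member meeting at most $k$ parts. A set $S$ is downward closed if it contains every descendant of each of its vertices. An $(X,\phi)$-balanced separator is a set $S\subseteq V(G)$ such that every connected component of $G-S$ contains at most $\phi|X|$ vertices of $X$. $\mathrm{fcov}_{\mathcal{F}}(S)$ is the minimum of $\sum_F y_F$ over nonnegative $\{y_F\}$ with $\sum_{F\ni v}y_F\ge1$ for all $v\in S$. -}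

module Defs where

open import Data.Nat as ℕ using (ℕ; zero; suc; _<ᵇ_)
open import Data.Integer using (+_)
open import Data.Fin using (Fin; toℕ; fromℕ)
open import Data.Fin.Subset using (Subset; _∈_; _∉_; _⊆_; ∣_∣)
open import Data.Bool using (Bool; true; false; if_then_else_; _∧_; _∨_; not; T)
open import Data.Rational using (ℚ; 0ℚ; 1ℚ; _+_; _*_; _≤_; _<_; _/_)
open import Data.Product using (Σ; _×_; ∃; ∃-syntax)
open import Data.Sum using (_⊎_)
open import Data.List using (List; length)
open import Data.List.Membership.Propositional using () renaming (_∈_ to _∈ₗ_)
open import Function.Bundles using (_⇔_)
open import Function.Definitions using (Injective)
open import Relation.Binary.PropositionalEquality using (_≡_)
open import Relation.Nullary using (¬_)

record Graph (n : ℕ) : Set where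
  field
    adj    : Fin n → Fin n → Bool
    sym    : ∀ u v → adj u v ≡ adj v u
    irrefl : ∀ u → adj u u ≡ false
open Graph public

∑ : ∀ {n} → (Fin n → ℚ) → ℚ
∑ {zero}  f = 0ℚ
∑ {suc n} f = f Data.Fin.zero + ∑ {n} (λ i → f (Data.Fin.suc i))

anyFin : ∀ {n} → (Fin n → Bool) → Bool
anyFin {zero}  f = false
anyFin {suc n} f = f Data.Fin.zero ∨ anyFin {n} (λ i → f (Data.Fin.suc i))

∑[_] : ∀ {n} → (Fin n → Bool) → (Fin n → ℚ) → ℚ
∑[ b ] f = ∑ (λ v → if b v then f v else 0ℚ)

memb : ∀ {n} → Subset n → Fin n → Bool
memb X v = Data.Vec.lookup X v
  where import Data.Vec

ℕtoℚ : ℕ → ℚ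
ℕtoℚ m = + m / 1

_^ℚ_ : ℚ → ℕ → ℚ
q ^ℚ zero  = 1ℚ
q ^ℚ suc m = q * (q ^ℚ m)

-- Layered families.  An ordered partition (L_1,…,L_m) is given by the
-- layer index  layer v  of each vertex (v ∈ L_(layer v)).

module Layered {n : ℕ} (G : Graph n) (layer : Fin n → ℕ) where

  arcᵇ : Fin n → Fin n → Bool
  arcᵇ u v = adj G u v ∧ (layer v <ᵇ layer u)

  Arc : Fin n → Fin n → Set
  Arc u v = T (arcᵇ u v)

  data Desc : Fin n → Fin n → Set where
    here  : ∀ {u} → Desc u u
    there : ∀ {u w v} → Arc u w → Desc w v → Desc u v

  isCenter : Fin n → Bool
  isCenter u = not (anyFin (λ w → arcᵇ w u))

  -- The family F consists of the sets  F_c = {descendants of c}  for the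
  -- centers c (distinct centers give distinct members), so the family is
  -- indexed by the centers.  A Boolean membership table  desc  with
  -- T (desc c v) ⇔ Desc c v  is passed around to make the sums computable.
  module WithTable (desc : Fin n → Fin n → Bool) where

    ThicknessAtMost : ℕ → Set
    ThicknessAtMost k =
      ∀ c → T (isCenter c) →
        Σ (List ℕ) λ ls → (length ls ℕ.≤ k) ×
          (∀ v → Desc c v → layer v ∈ₗ ls)

    DownwardClosed : Subset n → Set
    DownwardClosed S = ∀ u v → u ∈ S → Desc u v → v ∈ S

    FracCover : Subset n → (Fin n → ℚ) → Set
    FracCover S y =
      (∀ c → 0ℚ ≤ y c) ×
      (∀ v → v ∈ S → 1ℚ ≤ ∑[ (λ c → isCenter c ∧ desc c v) ] y)

    IsFcov : Subset n → ℚ → Set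
    IsFcov S c =
      (Σ (Fin n → ℚ) λ y → FracCover S y × (∑[ isCenter ] y ≡ c)) ×
      (∀ y → FracCover S y → c ≤ ∑[ isCenter ] y)

    record InducedPath (u v : Fin n) : Set where
      field
        len   : ℕ
        vert  : Fin (suc len) → Fin n
        start : vert Data.Fin.zero ≡ u
        end   : vert (fromℕ len) ≡ v
        inj   : Injective _≡_ _≡_ vert
        edges : ∀ i j → T (adj G (vert i) (vert j)) ⇔
                  ((suc (toℕ i) ≡ toℕ j) ⊎ (suc (toℕ j) ≡ toℕ i))

    meets : ∀ {u v} → Fin n → InducedPath u v → Bool
    meets c P = anyFin (λ i → desc c (InducedPath.vert P i))

    LPFeasible : Subset n → (Fin n → ℚ) → (Fin n → Fin n → ℚ) → Set
    LPFeasible X x d =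
      (∀ c → 0ℚ ≤ x c) ×
      (∀ u v → 0ℚ ≤ d u v) ×
      (∀ u → u ∈ X → ℕtoℚ ∣ X ∣ * (+ 1 / 10) ≤ ∑[ memb X ] (d u)) ×
      (∀ u v → u ∈ X → v ∈ X → (P : InducedPath u v) →
         d u v ≤ ∑[ (λ c → isCenter c ∧ meets c P) ] x) ×
      (∀ u v → u ∈ X → v ∈ X → d u v ≤ 1ℚ)

    IsLPOpt : Subset n → ℚ → Set
    IsLPOpt X f =
      (Σ (Fin n → ℚ) λ x → Σ (Fin n → Fin n → ℚ) λ d →
         LPFeasible X x d × (∑[ isCenter ] x ≡ f)) ×
      (∀ x d → LPFeasible X x d → f ≤ ∑[ isCenter ] x)

  data ConnAvoid (S : Subset n) : Fin n → Fin n → Set where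
    here  : ∀ {a} → a ∉ S → ConnAvoid S a a
    there : ∀ {a b c} → a ∉ S → T (adj G a b) → ConnAvoid S b c →
            ConnAvoid S a c

  -- (X, 95/100)-balanced separator: every component of G - S contains
  -- at most (95/100)|X| vertices of X
  BalancedSep : Subset n → Subset n → Set
  BalancedSep X S =
    ∀ a → a ∉ S → (Y : Subset n) → Y ⊆ X → (∀ y → y ∈ Y → ConnAvoid S a y) →
      100 ℕ.* ∣ Y ∣ ℕ.≤ 95 ℕ.* ∣ X ∣

-- Real-valued bound without reals.
-- Log2Above b p d  :⇔  p/(d+1) > log₂ b   (i.e.  b^(d+1) < 2^p), for b > 0.
Log2Above : ℚ → ℕ → ℕ → Set
Log2Above b p d = (b ^ℚ suc d) < (ℕtoℚ 2 ^ℚ p)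

-- BoundLE q k n f  :⇔  q ≤ 5000·k·log₂(2n)·log₂(f+4)·f.
-- Since k, f ≥ 0 and the logs are positive, this holds iff
-- q ≤ 5000·k·s·t·f for all rationals s > log₂(2n), t > log₂(f+4).
BoundLE : ℚ → ℕ → ℕ → ℚ → Set
BoundLE q k n f =
  ∀ p d p' d' → Log2Above (ℕtoℚ (2 ℕ.* n)) p d → Log2Above (f + ℕtoℚ 4) p' d' →
    q ≤ ℕtoℚ (5000 ℕ.* k) * (+ p / suc d) * (+ p' / suc d') * f

{-# OPTIONS --safe #-}

-- Write w v for the total LP weight of the members containing v.  Vertices of large w are
-- put into S at once: scaling up the LP solution covers them.  On the rest, which is closed
-- under ancestors, measure a walk by the total weight of the members that it meets.  Every
-- member meeting a directed path from a center c down to v contains v, so the distances D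
-- from a fixed u ∈ X satisfy D c ≤ D v ≤ D c + w v.  Hence the vertices with
-- r < D v ≤ r + w v separate the ball of radius r from its complement and are covered by
-- paying each member x_c / |r − D c|; averaged over r this costs only a factor log n.
-- Region growing, where the volume of a ball starts at a constant and never exceeds f,
-- finds a radius below 1/20 at which this is at most O(log n · log f) times the volume of
-- the ball, and carving balls one after the other charges each member once.  By the
-- spreading constraint a ball of radius 1/20 contains at most 18/19 of X.
-- The exact value of fcov exists by Fourier–Motzkin elimination.

module Submission where

open import Defs
open import Data.Bool using (Bool; true; false; if_then_else_; T; _∧_)
import Data.Bool.Properties as Boolₚ
open import Data.Empty using (⊥-elim)
open import Data.Fin using (Fin; zero; suc; toℕ; fromℕ)
import Data.Fin.Properties as Finₚ
open import Data.Fin.Subset using (Subset; _∈_; _∉_; _⊆_; ⁅_⁆; _∪_) renaming (∣_∣ to size; ⊥ to ∅)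
import Data.Fin.Subset.Properties as Subₚ
import Data.Integer as ℤ
import Data.Integer.Properties as ℤₚ
open import Data.List as List using (List; []; _∷_; _++_; foldr)
open import Data.List.Membership.Propositional.Properties using (∈-lookup)
open import Data.List.Relation.Unary.All as All using (All; []; _∷_)
import Data.List.Relation.Unary.All.Properties as Allₚ
open import Data.Nat using (ℕ; zero; suc; _+_; _*_; _∸_; _/_; _^_; _≤_; _<_; z≤n; s≤s; _≤?_; _<?_; ∣_-_∣; >-nonZero)
import Data.Nat.Coprimality as Coprimality
import Data.Nat.DivMod as DivMod
open import Data.Nat.Properties as ℕₚ using (module ≤-Reasoning)
open import Data.Nat.Tactic.RingSolver using (solve-∀)
open import Data.Product using (Σ; _×_; _,_; proj₁; proj₂; ∃-syntax)
open import Data.Rational as ℚ using (ℚ; 0ℚ; 1ℚ; mkℚ)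
import Data.Rational.Properties as ℚₚ
open import Data.Rational.Solver using (module +-*-Solver)
import Data.Rational.Unnormalised as ℚᵘ
import Data.Rational.Unnormalised.Properties as ℚᵘₚ
open import Data.Sum as Sum using (_⊎_; inj₁; inj₂; [_,_]′)
open import Data.Unit using (⊤; tt)
open import Data.Vec as Vec using (Vec; []; _∷_; _∷ʳ_)
import Data.Vec.Properties as Vecₚ
open import Function using (_∘_; id; Equivalence; mk⇔)
open import Function.Bundles using (_⇔_)
open import Relation.Binary.Definitions using (tri<; tri≈; tri>)
open import Relation.Binary.PropositionalEquality as ≡ using (_≡_; _≢_; refl; cong; cong₂; subst; subst₂)
open import Relation.Nullary using (Dec; yes; no; does; ¬_; ¬?; _×-dec_; _⊎-dec_; _→-dec_)
open import Relation.Nullary.Decidable as Dec using (T?; dec-true)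
open import Relation.Nullary.Negation using (contradiction)
open import Algebra.Properties.Semiring.Sum ℕₚ.+-*-semiring using (sum; sum-cong-≗; ∑-distrib-+; *-distribˡ-sum; *-distribʳ-sum; ∑-comm)

-- A walk pays once for a member that it meets many times, as in the path constraints, so the
-- distance is not a shortest-path metric of vertex weights. It is a minimum over sets of members,
-- and enters only through one-sided estimates: a step to `v` costs at most `w v`, and a return to
-- an ancestor costs nothing.
--
-- Integral weights turn the average over radii into a finite sum and cut off the singularity of the
-- price at distance 0; this is the source of log n. The scale is `e = 2 ^ E` with `e ≤ n < 2 * e`:
-- rounding the weights up adds at most `n` in total, and light vertices have `w v < e`, so the
-- harmonic sum has only `E` dyadic scales. Distance 1/20 becomes `5 * (J * e)` with `J = 5 * L` and
-- `L` about log(f + 4).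
--
-- A ball may be too light to start region growing. But a vertex at distance D forces a volume of at
-- least D, so around a light ball there is a layer that contains no vertex, and cutting there is
-- free.

-- Weighted sums over decidable predicates, and bounded search

sum-mono-≤ : ∀ {n} {f g : Fin n → ℕ} → (∀ i → f i ≤ g i) → sum f ≤ sum g
sum-mono-≤ {zero}  f≤g = z≤n
sum-mono-≤ {suc n} f≤g = ℕₚ.+-mono-≤ (f≤g zero) (sum-mono-≤ (f≤g ∘ suc))

wt : ∀ {n} {P : Fin n → Set} → (∀ i → Dec (P i)) → (Fin n → ℕ) → ℕ
wt P? f = sum (λ i → if does (P? i) then f i else 0)

module _ {n : ℕ} {P Q : Fin n → Set} (P? : ∀ i → Dec (P i)) (Q? : ∀ i → Dec (Q i)) where

  wt-mono : (f : Fin n → ℕ) → (∀ i → P i → Q i) → wt P? f ≤ wt Q? f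
  wt-mono f P⊆Q = sum-mono-≤ pointwise
    where
    pointwise : ∀ i → (if does (P? i) then f i else 0) ≤ (if does (Q? i) then f i else 0)
    pointwise i with P? i | Q? i
    ... | no _  | _     = z≤n
    ... | yes _ | yes _ = ℕₚ.≤-refl
    ... | yes p | no ¬q = contradiction (P⊆Q i p) ¬q

  module _ {R : Fin n → Set} (R? : ∀ i → Dec (R i)) (f : Fin n → ℕ) where

    wt-∪-≤ : (∀ i → R i → P i ⊎ Q i) → wt R? f ≤ wt P? f + wt Q? f
    wt-∪-≤ cover = begin
      wt R? f                                    ≤⟨ sum-mono-≤ pointwise ⟩
      sum (λ i → (if does (P? i) then f i else 0) + (if does (Q? i) then f i else 0))
                                                 ≡⟨ ∑-distrib-+ {n} _ _ ⟩
      wt P? f + wt Q? f                          ∎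
      where
      open ≤-Reasoning
      pointwise : ∀ i → (if does (R? i) then f i else 0) ≤
                        (if does (P? i) then f i else 0) + (if does (Q? i) then f i else 0)
      pointwise i with R? i | P? i | Q? i
      ... | no _  | _     | _     = z≤n
      ... | yes _ | yes _ | _     = ℕₚ.m≤m+n _ _
      ... | yes _ | no _  | yes _ = ℕₚ.≤-refl
      ... | yes r | no ¬p | no ¬q = ⊥-elim ([ ¬p , ¬q ]′ (cover i r))

    wt-disjoint-≤ : (∀ i → P i → R i) → (∀ i → Q i → R i) → (∀ i → P i → ¬ Q i) →
                    wt P? f + wt Q? f ≤ wt R? f
    wt-disjoint-≤ P⊆R Q⊆R disj = begin
      wt P? f + wt Q? f                          ≡⟨ ∑-distrib-+ {n} _ _ ⟨
      sum (λ i → (if does (P? i) then f i else 0) + (if does (Q? i) then f i else 0))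
                                                 ≤⟨ sum-mono-≤ pointwise ⟩
      wt R? f                                    ∎
      where
      open ≤-Reasoning
      pointwise : ∀ i → (if does (P? i) then f i else 0) + (if does (Q? i) then f i else 0) ≤
                        (if does (R? i) then f i else 0)
      pointwise i with P? i | Q? i | R? i
      ... | no _  | no _  | _     = z≤n
      ... | yes p | yes q | _     = contradiction q (disj i p)
      ... | yes _ | no _  | yes _ = ℕₚ.≤-reflexive (ℕₚ.+-identityʳ _)
      ... | no _  | yes _ | yes _ = ℕₚ.≤-refl
      ... | yes p | no _  | no ¬r = contradiction (P⊆R i p) ¬r
      ... | no _  | yes q | no ¬r = contradiction (Q⊆R i q) ¬r

wt-monoᶠ : ∀ {n} {P : Fin n → Set} (P? : ∀ i → Dec (P i)) {f g : Fin n → ℕ} →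
           (∀ i → f i ≤ g i) → wt P? f ≤ wt P? g
wt-monoᶠ P? {f} {g} f≤g = sum-mono-≤ pointwise
  where
  pointwise : ∀ i → (if does (P? i) then f i else 0) ≤ (if does (P? i) then g i else 0)
  pointwise i with P? i
  ... | yes _ = f≤g i
  ... | no  _ = z≤n

wt≤sum : ∀ {n} {P : Fin n → Set} (P? : ∀ i → Dec (P i)) (f : Fin n → ℕ) → wt P? f ≤ sum f
wt≤sum P? f = sum-mono-≤ pointwise
  where
  pointwise : ∀ i → (if does (P? i) then f i else 0) ≤ f i
  pointwise i with P? i
  ... | yes _ = ℕₚ.≤-refl
  ... | no  _ = z≤n

sum-const-≤ : ∀ N K (f : Fin N → ℕ) → (∀ i → K ≤ f i) → N * K ≤ sum f
sum-const-≤ zero    K f K≤f = z≤n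
sum-const-≤ (suc N) K f K≤f = ℕₚ.+-mono-≤ (K≤f zero) (sum-const-≤ N K (f ∘ suc) (K≤f ∘ suc))

sum-zero : ∀ {N} (f : Fin N → ℕ) → (∀ i → f i ≡ 0) → sum f ≡ 0
sum-zero {zero}  f f≡0 = refl
sum-zero {suc N} f f≡0 = cong₂ _+_ (f≡0 zero) (sum-zero (f ∘ suc) (f≡0 ∘ suc))

comprehension : ∀ {n} {P : Fin n → Set} → (∀ i → Dec (P i)) → Subset n
comprehension P? = Vec.tabulate (λ i → does (P? i))

module _ {n : ℕ} {P : Fin n → Set} (P? : ∀ i → Dec (P i)) where

  ∈-comprehension⁺ : ∀ {i} → P i → i ∈ comprehension P?
  ∈-comprehension⁺ {i} p = Vecₚ.lookup⇒[]= i _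
    (≡.trans (Vecₚ.lookup∘tabulate (λ i → does (P? i)) i) (dec-true (P? i) p))

  ∈-comprehension⁻ : ∀ {i} → i ∈ comprehension P? → P i
  ∈-comprehension⁻ {i} i∈ with P? i | ≡.trans (≡.sym (Vecₚ.lookup∘tabulate (λ i → does (P? i)) i)) (Vecₚ.[]=⇒lookup i∈)
  ... | yes p | _ = p

-- Bounded search whose default is the bound itself: if nothing below `B` satisfies `P`, the value
-- is `B`. This default is what truncates distances at the radius.
least : {P : ℕ → Set} → (∀ r → Dec (P r)) → ℕ → ℕ
least P? zero    = zero
least P? (suc B) with P? 0
... | yes _ = 0
... | no  _ = suc (least (P? ∘ suc) B)

least≤bound : {P : ℕ → Set} (P? : ∀ r → Dec (P r)) → ∀ B → least P? B ≤ B
least≤bound P? zero    = z≤n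
least≤bound P? (suc B) with P? 0
... | yes _ = z≤n
... | no  _ = s≤s (least≤bound (P? ∘ suc) B)

least-minimal : {P : ℕ → Set} (P? : ∀ r → Dec (P r)) → ∀ B {r} → P r → least P? B ≤ r
least-minimal P? zero    p = z≤n
least-minimal P? (suc B) {r} p with P? 0
... | yes _ = z≤n
least-minimal P? (suc B) {zero}  p | no ¬p = contradiction p ¬p
least-minimal P? (suc B) {suc r} p | no ¬p = s≤s (least-minimal (P? ∘ suc) B p)

least-holds : {P : ℕ → Set} (P? : ∀ r → Dec (P r)) → ∀ B → least P? B < B → P (least P? B)
least-holds P? (suc B) l<B with P? 0
... | yes p = p
least-holds P? (suc B) (s≤s l<B) | no _ = least-holds (P? ∘ suc) B l<B

-- Walks and induced paths

module Walks {n : ℕ} (G : Graph n) where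

  data Walk (P : Fin n → Set) : Fin n → Fin n → Set where
    here  : ∀ {a} → P a → Walk P a a
    there : ∀ {a b c} → P a → T (adj G a b) → Walk P b c → Walk P a c

  private variable
    P Q : Fin n → Set
    a b c : Fin n

  walk-map : (∀ {v} → P v → Q v) → Walk P a b → Walk Q a b
  walk-map P⊆Q (here p)      = here (P⊆Q p)
  walk-map P⊆Q (there p e w) = there (P⊆Q p) e (walk-map P⊆Q w)

  walk-start : Walk P a b → P a
  walk-start (here p)      = p
  walk-start (there p _ _) = p

  walk-end : Walk P a b → P b
  walk-end (here p)      = p
  walk-end (there _ _ w) = walk-end w

  infixr 5 _++ʷ_
  _++ʷ_ : Walk P a b → Walk P b c → Walk P a c
  here _      ++ʷ w′ = w′
  there p e w ++ʷ w′ = there p e (w ++ʷ w′)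

  adj-sym : T (adj G a b) → T (adj G b a)
  adj-sym {a} {b} = subst T (Graph.sym G a b)

  walk-reverse : Walk P a b → Walk P b a
  walk-reverse (here p)      = here p
  walk-reverse (there p e w) = walk-reverse w ++ʷ there (walk-start w) (adj-sym e) (here p)

  -- Lets every vertex of an optimal walk be bounded by its own prefix: it is no farther from the
  -- start than the end of the walk is.
  walk-prefixes : Walk P a b → Walk (λ v → Walk P a v) a b
  walk-prefixes {P = P} w = go (here (walk-start w)) w
    where
    go : ∀ {a b c} → Walk P a b → Walk P b c → Walk (λ v → Walk P a v) b c
    go pre (here p)      = here pre
    go pre (there p e w) = there pre e (go (pre ++ʷ there p e (here (walk-start w))) w)

  module _ (P? : ∀ v → Dec (P v)) (u : Fin n) where

    private
      Boundary : Subset n → Set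
      Boundary C = ∃[ b ] (b ∉ C × P b × ∃[ a ] (a ∈ C × T (adj G a b)))

      boundary? : ∀ C → Dec (Boundary C)
      boundary? C = Finₚ.any? λ b → ¬? (b Subₚ.∈? C) ×-dec P? b ×-dec
                      Finₚ.any? (λ a → a Subₚ.∈? C ×-dec T? (adj G a b))

      -- `k` is fuel: each boundary vertex that is added raises `size C` by at least one, which
      -- preserves `n < size C + k`, and at `k = 0` this would exceed the number of vertices.
      saturate : ∀ k (C : Subset n) → n < size C + k → u ∈ C → (∀ v → v ∈ C → Walk P u v) →
                 ∃[ D ] (u ∈ D × (∀ v → v ∈ D → Walk P u v) × ¬ Boundary D)
      saturate k C n<k u∈C sound with boundary? C
      ... | no ¬bd = C , u∈C , sound , ¬bd
      saturate zero C n<k u∈C sound | yes _ =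
        contradiction (Subₚ.∣p∣≤n C) (ℕₚ.<⇒≱ (subst (n <_) (ℕₚ.+-identityʳ _) n<k))
      saturate (suc k) C n<k u∈C sound | yes (b , b∉C , pb , a , a∈C , e) =
        saturate k (C ∪ ⁅ b ⁆) bound (Subₚ.x∈p∪q⁺ (inj₁ u∈C)) sound′
        where
        grows : size C < size (C ∪ ⁅ b ⁆)
        grows = Subₚ.p⊂q⇒∣p∣<∣q∣ ((λ x∈ → Subₚ.x∈p∪q⁺ (inj₁ x∈)) ,
                  b , Subₚ.x∈p∪q⁺ {p = C} (inj₂ (Subₚ.x∈⁅x⁆ b)) , b∉C)
        bound : n < size (C ∪ ⁅ b ⁆) + k
        bound = ℕₚ.<-≤-trans (subst (n <_) (ℕₚ.+-suc (size C) k) n<k) (ℕₚ.+-monoˡ-≤ k grows)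
        sound′ : ∀ v → v ∈ C ∪ ⁅ b ⁆ → Walk P u v
        sound′ v v∈ with Subₚ.x∈p∪q⁻ C ⁅ b ⁆ v∈
        ... | inj₁ v∈C = sound v v∈C
        ... | inj₂ v∈b with refl ← Subₚ.x∈⁅y⁆⇒x≡y b v∈b =
          let w = sound a a∈C in w ++ʷ there (walk-end w) e (here pb)

    walk? : ∀ v → Dec (Walk P u v)
    walk? v with P? u
    ... | no ¬pu = no (¬pu ∘ walk-start)
    ... | yes pu with saturate (suc n) ⁅ u ⁆ (ℕₚ.m≤n+m (suc n) _) (Subₚ.x∈⁅x⁆ u)
                        (λ v v∈ → subst (Walk P u) (≡.sym (Subₚ.x∈⁅y⁆⇒x≡y u v∈)) (here pu))
    ... | D , u∈D , sound , ¬bd with v Subₚ.∈? D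
    ...   | yes v∈D = yes (sound v v∈D)
    ...   | no  v∉D = no (λ w → v∉D (closed w u∈D))
      where
      closed : ∀ {a c} → Walk P a c → a ∈ D → c ∈ D
      closed (here _) a∈D = a∈D
      closed {a} (there {b = b} pa e w) a∈D with b Subₚ.∈? D
      ... | yes b∈D = closed w b∈D
      ... | no  b∉D = ⊥-elim (¬bd (b , b∉D , walk-start w , a , a∈D , e))

module InducedPaths {n : ℕ} (G : Graph n) (layer : Fin n → ℕ) (desc : Fin n → Fin n → Bool) where
  open Walks G
  open Layered.WithTable G layer desc using (InducedPath)

  ¬adj-refl : ∀ {a} → ¬ T (adj G a a)
  ¬adj-refl {a} = subst T (irrefl G a)

  Apart : Fin n → Fin n → Set
  Apart a z = ¬ T (adj G a z) × a ≢ z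

  -- Induced a l : the vertex sequence  a ∷ l  is an induced path.
  Induced : Fin n → List (Fin n) → Set
  Induced a []      = ⊤
  Induced a (b ∷ l) = T (adj G a b) × All (Apart a) l × Induced b l

  final : Fin n → List (Fin n) → Fin n
  final a []      = a
  final a (b ∷ l) = final b l

  module _ {P : Fin n → Set} where

    -- Continue from a at the last vertex of the path that equals or neighbours a.
    shortcut : ∀ a b l → Induced b l → All P (b ∷ l) →
               (∃[ l′ ] (Induced a l′ × final a l′ ≡ final b l × All P l′)) ⊎ All (Apart a) (b ∷ l)
    shortcut a b l ind ps = [ inj₁ , atHead ]′ (inTail l ind ps)
      where
      inTail : ∀ l → Induced b l → All P (b ∷ l) →
               (∃[ l′ ] (Induced a l′ × final a l′ ≡ final b l × All P l′)) ⊎ All (Apart a) l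
      inTail []      _             _        = inj₂ []
      inTail (c ∷ l) (_ , _ , ind) (_ ∷ ps) = shortcut a c l ind ps
      atHead : All (Apart a) l →
               (∃[ l′ ] (Induced a l′ × final a l′ ≡ final b l × All P l′)) ⊎ All (Apart a) (b ∷ l)
      atHead off with a Finₚ.≟ b | T? (adj G a b)
      ... | yes refl | _     = inj₁ (l , ind , refl , All.tail ps)
      ... | no _     | yes e = inj₁ (b ∷ l , (e , off , ind) , refl , ps)
      ... | no a≢b   | no ¬e = inj₂ ((¬e , a≢b) ∷ off)

    walk⇒induced : ∀ {a c} → Walk P a c → ∃[ l ] (Induced a l × final a l ≡ c × All P (a ∷ l))
    walk⇒induced (here p) = [] , tt , refl , p ∷ []
    walk⇒induced {a} (there {b = b} p e w) with walk⇒induced w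
    ... | l , ind , fin , ps with shortcut a b l ind ps
    ...   | inj₁ (l′ , ind′ , fin′ , ps′) = l′ , ind′ , ≡.trans fin′ fin , p ∷ ps′
    -- Being apart from the whole path includes being apart from `b`, which `e` joins to `a`.
    ...   | inj₂ ((¬e , _) ∷ _)           = contradiction e ¬e

  lookup-final : ∀ a l → List.lookup (a ∷ l) (fromℕ (List.length l)) ≡ final a l
  lookup-final a []      = refl
  lookup-final a (b ∷ l) = lookup-final b l

  head∉tail : ∀ a l → Induced a l → ∀ i → a ≢ List.lookup l i
  head∉tail a (b ∷ l) (e , _ , _)   zero    refl = ¬adj-refl e
  head∉tail a (b ∷ l) (_ , off , _) (suc i)      = proj₂ (All.lookup off (∈-lookup i))

  lookup-injective : ∀ a l → Induced a l → ∀ {i j} → List.lookup (a ∷ l) i ≡ List.lookup (a ∷ l) j → i ≡ j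
  lookup-injective a l ind {zero}  {zero}  _  = refl
  lookup-injective a l ind {zero}  {suc j} eq = contradiction eq (head∉tail a l ind j)
  lookup-injective a l ind {suc i} {zero}  eq = contradiction (≡.sym eq) (head∉tail a l ind i)
  lookup-injective a (b ∷ l) (_ , _ , ind) {suc i} {suc j} eq = cong suc (lookup-injective b l ind eq)

  Consecutive : ∀ {m} → Fin m → Fin m → Set
  Consecutive i j = (suc (toℕ i) ≡ toℕ j) ⊎ (suc (toℕ j) ≡ toℕ i)

  head-edges : ∀ a l → Induced a l → ∀ j → T (adj G a (List.lookup (a ∷ l) j)) ⇔ Consecutive {suc (List.length l)} zero j
  head-edges a l ind zero = mk⇔ (λ e → contradiction e ¬adj-refl) λ { (inj₁ ()) ; (inj₂ ()) }
  head-edges a (b ∷ l) (e , _ , _) (suc zero) = mk⇔ (λ _ → inj₁ refl) (λ _ → e)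
  head-edges a (b ∷ l) (_ , off , _) (suc (suc j)) =
    mk⇔ (λ e → contradiction e (proj₁ (All.lookup off (∈-lookup j)))) λ { (inj₁ ()) ; (inj₂ ()) }

  lookup-edges : ∀ a l → Induced a l → ∀ i j →
                 T (adj G (List.lookup (a ∷ l) i) (List.lookup (a ∷ l) j)) ⇔ Consecutive i j
  lookup-edges a l ind zero    j    = head-edges a l ind j
  lookup-edges a l ind (suc i) zero =
    let eq = head-edges a l ind (suc i) in
    mk⇔ (Sum.swap ∘ Equivalence.to eq ∘ adj-sym) (adj-sym ∘ Equivalence.from eq ∘ Sum.swap)
  lookup-edges a (b ∷ l) (_ , _ , ind) (suc i) (suc j) =
    let eq = lookup-edges b l ind i j in
    mk⇔ (Sum.map (cong suc) (cong suc) ∘ Equivalence.to eq)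
        (Equivalence.from eq ∘ Sum.map ℕₚ.suc-injective ℕₚ.suc-injective)

  -- The linear program constrains induced paths only, whereas balls consist of walks. The path
  -- keeps to vertices satisfying `P`, so it meets no member that `P` excludes.
  inducedPath : ∀ {P : Fin n → Set} {a c} → Walk P a c →
                Σ (InducedPath a c) λ p → ∀ i → P (InducedPath.vert p i)
  inducedPath {a = a} w with walk⇒induced w
  ... | l , ind , fin , ps = record
    { len   = List.length l
    ; vert  = List.lookup (a ∷ l)
    ; start = refl
    ; end   = ≡.trans (lookup-final a l) fin
    ; inj   = lookup-injective a l ind
    ; edges = lookup-edges a l ind
    } , λ i → All.lookup ps (∈-lookup i)

-- Sums over initial segments, and a dyadic majorant of the reciprocal

sum< : ℕ → (ℕ → ℕ) → ℕ
sum< N g = sum {N} (g ∘ toℕ)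

sum<-last : ∀ N g → sum< (suc N) g ≡ sum< N g + g N
sum<-last zero    g = ℕₚ.+-identityʳ (g 0)
sum<-last (suc N) g = ≡.trans (cong (g 0 +_) (sum<-last N (g ∘ suc))) (≡.sym (ℕₚ.+-assoc (g 0) _ _))

sum<-shift-≤ : ∀ s N g → sum< N (λ i → g (s + i)) ≤ sum< (s + N) g
sum<-shift-≤ zero    N g = ℕₚ.≤-refl
sum<-shift-≤ (suc s) N g = ℕₚ.≤-trans (sum<-shift-≤ s N (g ∘ suc)) (ℕₚ.m≤n+m _ (g 0))

-- On either side of `D` the distance takes each value at most once: values up to `D` on the left,
-- values below `N` on the right.
sum<-distance-≤ : ∀ N D g → sum< N (λ i → g ∣ i - D ∣) ≤ sum< (suc D) g + sum< N g
sum<-distance-≤ N zero g = ℕₚ.≤-trans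
  (ℕₚ.≤-reflexive (sum-cong-≗ {N} (λ i → cong g (ℕₚ.∣-∣-identityʳ (toℕ i)))))
  (ℕₚ.m≤n+m _ (g 0 + 0))
sum<-distance-≤ zero    (suc D) g = z≤n
sum<-distance-≤ (suc N) (suc D) g = begin
  g (suc D) + sum< N (λ i → g ∣ i - D ∣)         ≤⟨ ℕₚ.+-monoʳ-≤ (g (suc D)) (sum<-distance-≤ N D g) ⟩
  g (suc D) + (sum< (suc D) g + sum< N g)        ≡⟨ lemma (g (suc D)) (sum< (suc D) g) (sum< N g) ⟩
  (sum< (suc D) g + g (suc D)) + sum< N g        ≡⟨ cong (_+ sum< N g) (sum<-last (suc D) g) ⟨
  sum< (suc (suc D)) g + sum< N g                ≤⟨ ℕₚ.+-monoʳ-≤ (sum< (suc (suc D)) g) (ℕₚ.m≤m+n _ (g N)) ⟩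
  sum< (suc (suc D)) g + (sum< N g + g N)        ≡⟨ cong (sum< (suc (suc D)) g +_) (sum<-last N g) ⟨
  sum< (suc (suc D)) g + sum< (suc N) g          ∎
  where
  open ≤-Reasoning
  lemma : ∀ a b c → a + (b + c) ≡ (b + a) + c
  lemma = solve-∀

below : ℕ → ℕ → ℕ
below zero    t       = 0
below (suc K) zero    = 1
below (suc K) (suc t) = below K t

below-< : ∀ {K t} → t < K → below K t ≡ 1
below-< {suc K} {zero}  _         = refl
below-< {suc K} {suc t} (s≤s t<K) = below-< t<K

below-≥ : ∀ {K t} → K ≤ t → below K t ≡ 0
below-≥ z≤n       = refl
below-≥ (s≤s K≤t) = below-≥ K≤t

sum<-below-≤ : ∀ N K → sum< N (below K) ≤ K
sum<-below-≤ zero    K       = z≤n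
sum<-below-≤ (suc N) zero    = sum<-below-≤ N zero
sum<-below-≤ (suc N) (suc K) = s≤s (sum<-below-≤ N K)

-- An integral majorant of 2^E / t on 0 < t < 2^E, supported on t < 2^E, whose total
-- mass is only logarithmically larger than 2^E.
kernel : ℕ → ℕ → ℕ
kernel zero    t = 0
kernel (suc E) t = 2 * (kernel E t + below (2 ^ suc E) t)

-- Unfolded, `kernel E t` is the sum of 2^(E-j+1) over those j from 1 to `E` with t < 2^j. The
-- single j with 2^(j-1) ≤ w < 2^j already suffices, since t ≤ w.
kernel-lower : ∀ E {t w} → t ≤ w → 1 ≤ w → w < 2 ^ E → 2 ^ E ≤ kernel E t * w
kernel-lower zero    t≤w 1≤w w<1 = contradiction 1≤w (ℕₚ.<⇒≱ w<1)
kernel-lower (suc E) {t} {w} t≤w 1≤w w<2^E with w <? 2 ^ E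
... | yes w<e = begin
  2 * 2 ^ E                     ≤⟨ ℕₚ.*-monoʳ-≤ 2 (kernel-lower E t≤w 1≤w w<e) ⟩
  2 * (kernel E t * w)          ≡⟨ ℕₚ.*-assoc 2 (kernel E t) w ⟨
  2 * kernel E t * w            ≤⟨ ℕₚ.*-monoˡ-≤ w (ℕₚ.*-monoʳ-≤ 2 (ℕₚ.m≤m+n (kernel E t) _)) ⟩
  kernel (suc E) t * w          ∎
  where open ≤-Reasoning
... | no w≮e rewrite below-< (ℕₚ.≤-<-trans t≤w w<2^E) =
  ℕₚ.*-mono-≤ (ℕₚ.*-monoʳ-≤ 2 (ℕₚ.m≤n+m 1 (kernel E t))) (ℕₚ.≮⇒≥ w≮e)

kernel-vanish : ∀ E {t} → 2 ^ E ≤ t → kernel E t ≡ 0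
kernel-vanish zero    _ = refl
kernel-vanish (suc E) e≤t
  rewrite below-≥ e≤t | kernel-vanish E (ℕₚ.≤-trans (ℕₚ.m≤m+n _ _) e≤t) = refl

-- Each of the `E` dyadic scales is a step of height 2^(E-j+1) and width 2^j, so of mass at most
-- `2 * 2 ^ E`.
kernel-sum : ∀ E N → sum< N (kernel E) ≤ 2 * E * 2 ^ E
kernel-sum zero    N = ℕₚ.≤-reflexive (zeros N)
  where
  zeros : ∀ N → sum< N (λ _ → 0) ≡ 0
  zeros zero    = refl
  zeros (suc N) = zeros N
kernel-sum (suc E) N = begin
  sum< N (kernel (suc E))          ≡⟨ *-distribˡ-sum {N} 2 _ ⟨
  2 * sum {N} (λ i → kernel E (toℕ i) + below (2 ^ suc E) (toℕ i))
                                   ≡⟨ cong (2 *_) (∑-distrib-+ {N} (kernel E ∘ toℕ) (below (2 ^ suc E) ∘ toℕ)) ⟩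
  2 * (sum< N (kernel E) + sum< N (below (2 ^ suc E)))
    ≤⟨ ℕₚ.*-monoʳ-≤ 2 (ℕₚ.+-mono-≤ (kernel-sum E N) (sum<-below-≤ N (2 ^ suc E))) ⟩
  2 * (2 * E * 2 ^ E + 2 * 2 ^ E)  ≡⟨ lemma E (2 ^ E) ⟩
  2 * suc E * (2 * 2 ^ E)          ∎
  where
  open ≤-Reasoning
  lemma : ∀ E e → 2 * (2 * E * e + 2 * e) ≡ 2 * suc E * (2 * e)
  lemma = solve-∀

kernel-distance-sum : ∀ E s N D → sum< N (λ i → kernel E ∣ s + i - D ∣) ≤ 4 * E * 2 ^ E
kernel-distance-sum E s N D = begin
  sum< N (λ i → kernel E ∣ s + i - D ∣)             ≤⟨ sum<-shift-≤ s N (λ i → kernel E ∣ i - D ∣) ⟩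
  sum< (s + N) (λ i → kernel E ∣ i - D ∣)           ≤⟨ sum<-distance-≤ (s + N) D (kernel E) ⟩
  sum< (suc D) (kernel E) + sum< (s + N) (kernel E) ≤⟨ ℕₚ.+-mono-≤ (kernel-sum E (suc D)) (kernel-sum E (s + N)) ⟩
  2 * E * 2 ^ E + 2 * E * 2 ^ E                     ≡⟨ lemma E (2 ^ E) ⟩
  4 * E * 2 ^ E                                     ∎
  where
  open ≤-Reasoning
  lemma : ∀ E e → 2 * E * e + 2 * E * e ≡ 4 * E * e
  lemma = solve-∀

-- Region growing

distance-≤ : ∀ {x y w} → x ≤ y + w → y ≤ x + w → ∣ x - y ∣ ≤ w
distance-≤ {x} {y} x≤y+w y≤x+w with ℕₚ.≤-total x y
... | inj₁ x≤y = ℕₚ.≤-trans (ℕₚ.≤-reflexive (ℕₚ.m≤n⇒∣m-n∣≡n∸m x≤y)) (ℕₚ.m≤n+o⇒m∸n≤o y x y≤x+w)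
... | inj₂ y≤x = ℕₚ.≤-trans (ℕₚ.≤-reflexive (ℕₚ.m≤n⇒∣n-m∣≡n∸m y≤x)) (ℕₚ.m≤n+o⇒m∸n≤o x y x≤y+w)

distance-≥ : ∀ {x y d} → y + d ≤ x → d ≤ ∣ x - y ∣
distance-≥ {x} {y} {d} y+d≤x = begin
  d          ≤⟨ ℕₚ.m+n≤o⇒m≤o∸n d (subst (_≤ x) (ℕₚ.+-comm y d) y+d≤x) ⟩
  x ∸ y      ≡⟨ ℕₚ.m≤n⇒∣n-m∣≡n∸m (ℕₚ.m+n≤o⇒m≤o y y+d≤x) ⟨
  ∣ x - y ∣  ∎
  where open ≤-Reasoning

module Carving {n : ℕ} (G : Graph n) (layer : Fin n → ℕ) (desc : Fin n → Fin n → Bool)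
  (desc⇔ : ∀ c v → T (desc c v) ⇔ Layered.Desc G layer c v) (m : Fin n → ℕ) (E J : ℕ) where

  open Layered G layer using (Desc; here; there; isCenter; ConnAvoid)
  open Layered.WithTable G layer desc using (DownwardClosed)
  open Walks G

  -- Covers are scaled by e to stay integral: a vertex is covered once its members pay e.
  e : ℕ
  e = 2 ^ E

  -- Of the five parts, one is the starting radius `J * e`, one makes room for a further `e`, and
  -- three hold `J` windows of length `3 * e` in which the volume could double.
  radius : ℕ
  radius = 5 * (J * e)

  Cov : Fin n → Fin n → Set
  Cov v c = T (isCenter c ∧ desc c v)

  cov? : ∀ v c → Dec (Cov v c)
  cov? v c = T? (isCenter c ∧ desc c v)

  w : Fin n → ℕ
  w v = wt (cov? v) m

  cov-center : ∀ {v c} → Cov v c → T (isCenter c)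
  cov-center = proj₁ ∘ Equivalence.to Boolₚ.T-∧

  cov-desc : ∀ {v c} → Cov v c → Desc c v
  cov-desc {v} {c} = Equivalence.to (desc⇔ c v) ∘ proj₂ ∘ Equivalence.to Boolₚ.T-∧

  desc-trans : ∀ {a b c} → Desc a b → Desc b c → Desc a c
  desc-trans here        q = q
  desc-trans (there x p) q = there x (desc-trans p q)

  cov-down : ∀ {a v c} → Desc a v → Cov a c → Cov v c
  cov-down {a} {v} {c} d cov = Equivalence.from Boolₚ.T-∧
    (cov-center cov , Equivalence.from (desc⇔ c v) (desc-trans (cov-desc cov) d))

  desc-walk : ∀ {a v} → Desc a v → Walk (λ z → Desc z v) a v
  desc-walk here        = here here
  desc-walk (there x d) = there (there x d) (proj₁ (Equivalence.to Boolₚ.T-∧ x)) (desc-walk d)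

  -- The invariant of the carving: every directed path into a vertex of `A` stays inside `A`, and so
  -- do the centers of all members through that vertex.
  UpwardClosed : Subset n → Set
  UpwardClosed A = ∀ {a v} → Desc a v → v ∈ A → a ∈ A

  CenterIn : Subset n → Fin n → Set
  CenterIn A c = T (isCenter c) × c ∈ A

  centerIn? : ∀ A c → Dec (CenterIn A c)
  centerIn? A c = T? (isCenter c) ×-dec (c Subₚ.∈? A)

  -- The walk may use all of `G`, as the paths of the linear program do. Closeness found while
  -- carving a smaller set therefore remains valid later.
  Close : Fin n → Fin n → Set
  Close u v = ∃[ F ] (wt (Subₚ._∈? F) m ≤ radius × Walk (λ z → ∀ c → Cov z c → c ∈ F) u v)

  module Ball (A : Subset n) (up : UpwardClosed A) (u : Fin n) where

    Good : Subset n → Fin n → Set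
    Good F z = z ∈ A × (∀ c → Cov z c → c ∈ F)

    good? : ∀ F z → Dec (Good F z)
    good? F z = z Subₚ.∈? A ×-dec Finₚ.all? (λ c → cov? z c →-dec (c Subₚ.∈? F))

    Reach : Fin n → ℕ → Set
    Reach v r = ∃[ F ] (wt (Subₚ._∈? F) m ≤ r × Walk (Good F) u v)

    reach? : ∀ v r → Dec (Reach v r)
    reach? v r = Subₚ.anySubset? (λ F → (wt (Subₚ._∈? F) m ≤? r) ×-dec walk? (good? F) u v)

    -- The least weight of a set of members containing all members that meet some walk
    -- from u to v inside A, truncated at the radius.
    D : Fin n → ℕ
    D v = least (reach? v) radius

    D-minimal : ∀ {v r} → Reach v r → D v ≤ r
    D-minimal {v} = least-minimal (reach? v) radius

    D-reach : ∀ {v} → D v < radius → Reach v (D v)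
    D-reach {v} = least-holds (reach? v) radius

    -- Adding the members through `v` to an optimal set for `a` costs at most `w v` and permits
    -- every vertex of `A` whose members all contain `v`. The abstract continuation covers both a
    -- single edge and a whole directed path. If `D a` is truncated, the bound holds because `D v`
    -- is truncated too.
    D-extend : ∀ {a v} →
      (∀ {F} → Good F a → (∀ {z} → z ∈ A → (∀ {c} → Cov z c → Cov v c) → Good F z) → Walk (Good F) a v) →
      D v ≤ D a + w v
    D-extend {a} {v} walk with D a <? radius
    ... | no D≮ = ℕₚ.≤-trans (least≤bound (reach? v) radius) (ℕₚ.≤-trans (ℕₚ.≮⇒≥ D≮) (ℕₚ.m≤m+n _ _))
    ... | yes D< with D-reach {a} D<
    ...   | F , wt≤ , W = D-minimal (F′ , bound , W′ ++ʷ walk (walk-end W′) good-v)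
      where
      F′? : ∀ c → Dec (c ∈ F ⊎ Cov v c)
      F′? c = (c Subₚ.∈? F) ⊎-dec cov? v c
      F′ : Subset n
      F′ = comprehension F′?
      bound : wt (Subₚ._∈? F′) m ≤ D a + w v
      bound = ℕₚ.≤-trans (wt-∪-≤ (Subₚ._∈? F) (cov? v) (Subₚ._∈? F′) m (λ c → ∈-comprehension⁻ F′?))
                (ℕₚ.+-monoˡ-≤ (w v) wt≤)
      W′ : Walk (Good F′) u a
      W′ = walk-map (λ (z∈A , z⊆F) → z∈A , λ c cov → ∈-comprehension⁺ F′? (inj₁ (z⊆F c cov))) W
      good-v : ∀ {z} → z ∈ A → (∀ {c} → Cov z c → Cov v c) → Good F′ z
      good-v z∈A z⊆v = z∈A , λ c cov → ∈-comprehension⁺ F′? (inj₂ (z⊆v cov))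

    D-edge : ∀ {a b} → b ∈ A → T (adj G a b) → D b ≤ D a + w b
    D-edge b∈A ab = D-extend (λ good-a good → there good-a ab (here (good b∈A id)))

    D-down : ∀ {a v} → v ∈ A → Desc a v → D v ≤ D a + w v
    D-down v∈A d = D-extend (λ _ good → walk-map (λ d′ → good (up d′ v∈A) (cov-down d′)) (desc-walk d))

    -- All members meeting a directed path into v contain v, so walking back up is free.
    D-up : ∀ {a v} → Desc a v → D a ≤ D v
    D-up {a} {v} d with D v <? radius
    ... | no D≮ = ℕₚ.≤-trans (least≤bound (reach? a) radius) (ℕₚ.≮⇒≥ D≮)
    ... | yes D< with D-reach {v} D<
    ...   | F , wt≤ , W = D-minimal (F , wt≤ , W ++ʷ walk-map good (walk-reverse (desc-walk d)))
      where
      good : ∀ {z} → Desc z v → Good F z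
      good d′ = up d′ (proj₁ (walk-end W)) , λ c cov → proj₂ (walk-end W) c (cov-down d′ cov)

    Vol : ℕ → Fin n → Set
    Vol r c = CenterIn A c × D c ≤ r

    vol? : ∀ r c → Dec (Vol r c)
    vol? r c = centerIn? A c ×-dec (D c ≤? r)

    vol : ℕ → ℕ
    vol r = wt (vol? r) m

    vol-mono : ∀ {r s} → r ≤ s → vol r ≤ vol s
    vol-mono {r} {s} r≤s = wt-mono (vol? r) (vol? s) m (λ c (c∈A , D≤r) → c∈A , ℕₚ.≤-trans D≤r r≤s)

    -- On a walk realising `D z`, each vertex is within `D z` by its prefix, and by `D-up` so are
    -- the centers of the members through it. The members centered in the ball thus themselves
    -- permit the walk, and their weight bounds `D z`.
    D≤vol : ∀ {z} → D z < radius → D z ≤ vol (D z)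
    D≤vol {z} D< with D-reach {z} D<
    ... | F , wt≤ , W = D-minimal (ball , bound , walk-map good (walk-prefixes W))
      where
      ball : Subset n
      ball = comprehension (vol? (D z))
      bound : wt (Subₚ._∈? ball) m ≤ vol (D z)
      bound = wt-mono (Subₚ._∈? ball) (vol? (D z)) m (λ c → ∈-comprehension⁻ (vol? (D z)))
      good : ∀ {v} → Walk (Good F) u v → Good ball v
      good W′ = v∈A , λ c cov → ∈-comprehension⁺ (vol? (D z))
          ((cov-center cov , up (cov-desc cov) v∈A) ,
           ℕₚ.≤-trans (D-up (cov-desc cov)) (D-minimal (F , wt≤ , W′)))
        where v∈A = proj₁ (walk-end W′)

    Cut : ℕ → Fin n → Set
    Cut r v = v ∈ A × r < D v × D v ≤ r + w v

    cut? : ∀ r v → Dec (Cut r v)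
    cut? r v = (v Subₚ.∈? A) ×-dec (r <? D v) ×-dec (D v ≤? r + w v)

    price : ℕ → Fin n → ℕ
    price r c = if does (centerIn? A c) then m c * kernel E ∣ r - D c ∣ else 0

    cost : ℕ → ℕ
    cost r = sum (price r)

    -- A member through a cut vertex v has its center within w v of the sphere of radius r,
    -- so its price is at least m c * e / w v.
    cut-covered : (∀ v → v ∈ A → w v < e) → ∀ r v → Cut r v → e ≤ wt (cov? v) (price r)
    cut-covered light r v (v∈A , r<D , D≤r+w) =
      ℕₚ.*-cancelʳ-≤ e _ (w v) {{>-nonZero 1≤w}} (begin
        e * w v                                                      ≡⟨ *-distribˡ-sum {n} e _ ⟩
        sum (λ c → e * (if does (cov? v c) then m c else 0))
          ≤⟨ sum-mono-≤ (λ c → pointwise c (cov? v c) (centerIn? A c)) ⟩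
        sum (λ c → (if does (cov? v c) then price r c else 0) * w v) ≡⟨ *-distribʳ-sum {n} (w v) _ ⟨
        wt (cov? v) (price r) * w v                                  ∎)
      where
      open ≤-Reasoning
      1≤w : 1 ≤ w v
      1≤w = ℕₚ.+-cancelˡ-≤ r 1 (w v) (subst (_≤ r + w v) (ℕₚ.+-comm 1 r) (ℕₚ.≤-trans r<D D≤r+w))
      near : ∀ {c} → Cov v c → ∣ r - D c ∣ ≤ w v
      near cov = distance-≤
        (ℕₚ.≤-trans (ℕₚ.<⇒≤ r<D) (D-down v∈A (cov-desc cov)))
        (ℕₚ.≤-trans (D-up (cov-desc cov)) D≤r+w)
      pointwise : ∀ c (x : Dec (Cov v c)) (y : Dec (CenterIn A c)) →
        e * (if does x then m c else 0) ≤
        (if does x then (if does y then m c * kernel E ∣ r - D c ∣ else 0) else 0) * w v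
      pointwise c (no _)    _       = ℕₚ.≤-reflexive (ℕₚ.*-zeroʳ e)
      pointwise c (yes cov) (no ¬c) = contradiction (cov-center cov , up (cov-desc cov) v∈A) ¬c
      pointwise c (yes cov) (yes _) = begin
        e * m c                                ≡⟨ ℕₚ.*-comm e (m c) ⟩
        m c * e                                ≤⟨ ℕₚ.*-monoʳ-≤ (m c) (kernel-lower E (near cov) 1≤w (light v v∈A)) ⟩
        m c * (kernel E ∣ r - D c ∣ * w v)     ≡⟨ ℕₚ.*-assoc (m c) _ _ ⟨
        m c * kernel E ∣ r - D c ∣ * w v       ∎

    -- Prices vanish at distance `e` or more, so radii in the middle third of the window charge only
    -- centers between `a` and `a + 3 * e`, each at most `4 * E * e` times its weight. The outer
    -- thirds exist to isolate these centers from the rest.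
    block-cost : ∀ a → sum< e (λ i → cost (a + e + i)) + 4 * E * e * vol a ≤ 4 * E * e * vol (a + 3 * e)
    block-cost a = begin
      sum< e (λ i → cost (a + e + i)) + C * vol a
        ≡⟨ cong₂ _+_ (∑-comm {e} {n} (λ i → price (a + e + toℕ i))) (*-distribˡ-sum {n} C _) ⟩
      sum (λ c → sum< e (λ i → price (a + e + i) c)) + sum (λ c → C * (if does (vol? a c) then m c else 0))
        ≡⟨ ∑-distrib-+ {n} _ _ ⟨
      sum (λ c → sum< e (λ i → price (a + e + i) c) + C * (if does (vol? a c) then m c else 0))
        ≤⟨ sum-mono-≤ (λ c → pointwise c (centerIn? A c) (D c ≤? a) (D c ≤? a + 3 * e)) ⟩
      sum (λ c → C * (if does (vol? (a + 3 * e) c) then m c else 0))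
        ≡⟨ *-distribˡ-sum {n} C _ ⟨
      C * vol (a + 3 * e) ∎
      where
      open ≤-Reasoning
      C : ℕ
      C = 4 * E * e
      far : ∀ c → (∀ i → i < e → e ≤ ∣ a + e + i - D c ∣) →
            sum< e (λ i → m c * kernel E ∣ a + e + i - D c ∣) ≡ 0
      far c dist = sum-zero {e} _ (λ i → ≡.trans
        (cong (m c *_) (kernel-vanish E (dist (toℕ i) (Finₚ.toℕ<n i)))) (ℕₚ.*-zeroʳ (m c)))
      pointwise : ∀ c (x : Dec (CenterIn A c)) (y : Dec (D c ≤ a)) (z : Dec (D c ≤ a + 3 * e)) →
        sum< e (λ i → if does x then m c * kernel E ∣ a + e + i - D c ∣ else 0) +
          C * (if does (x ×-dec y) then m c else 0) ≤
        C * (if does (x ×-dec z) then m c else 0)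
      pointwise c (no _) y z =
        ℕₚ.≤-reflexive (cong (_+ C * 0) (sum-zero {e} (λ _ → 0) (λ _ → refl)))
      pointwise c (yes _) (yes D≤a) (no D≰) =
        contradiction (ℕₚ.≤-trans D≤a (ℕₚ.m≤m+n a _)) D≰
      pointwise c (yes _) (yes D≤a) (yes _) = ℕₚ.≤-reflexive (cong (_+ C * m c) (far c (λ i _ →
        distance-≥ (ℕₚ.≤-trans (ℕₚ.+-monoˡ-≤ e D≤a) (ℕₚ.m≤m+n (a + e) i)))))
      pointwise c (yes _) (no _) (yes _) = begin
        sum< e (λ i → m c * kernel E ∣ a + e + i - D c ∣) + C * 0
          ≡⟨ cong₂ _+_ (*-distribˡ-sum {e} (m c) _) (≡.sym (ℕₚ.*-zeroʳ C)) ⟨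
        m c * sum< e (λ i → kernel E ∣ a + e + i - D c ∣) + 0
          ≡⟨ ℕₚ.+-identityʳ _ ⟩
        m c * sum< e (λ i → kernel E ∣ a + e + i - D c ∣)
          ≤⟨ ℕₚ.*-monoʳ-≤ (m c) (kernel-distance-sum E (a + e) e (D c)) ⟩
        m c * C ≡⟨ ℕₚ.*-comm (m c) C ⟩
        C * m c ∎
      pointwise c (yes _) (no _) (no D≰) = ℕₚ.≤-reflexive (cong (_+ C * 0) (far c (λ i i<e →
        subst (e ≤_) (ℕₚ.∣-∣-comm (D c) (a + e + i)) (distance-≥ (begin
          a + e + i + e      ≤⟨ ℕₚ.+-monoˡ-≤ e (ℕₚ.+-monoʳ-≤ (a + e) (ℕₚ.<⇒≤ i<e)) ⟩
          a + e + e + e      ≡⟨ lemma a e ⟩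
          a + 3 * e          ≤⟨ ℕₚ.<⇒≤ (ℕₚ.≰⇒> D≰) ⟩
          D c                ∎)))))
        where
        lemma : ∀ a e → a + e + e + e ≡ a + 3 * e
        lemma = solve-∀

    Cheap : ℕ → Set
    Cheap r = cost r ≤ 4 * E * vol r

    -- If no radius in the middle third of the window is cheap, then averaging the cost over
    -- that third shows that the volume doubles across the window.
    cheap-or-double : ∀ a → (∃[ r ] (a ≤ r × r < a + 3 * e × Cheap r)) ⊎ 2 * vol a ≤ vol (a + 3 * e)
    cheap-or-double a with Finₚ.any? {n = e} (λ i → cost (a + e + toℕ i) ≤? 4 * E * vol (a + e + toℕ i))
    ... | yes (i , cheap) = inj₁ (a + e + toℕ i , ℕₚ.≤-trans (ℕₚ.m≤m+n a e) (ℕₚ.m≤m+n _ _) , r<  , cheap)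
      where
      open ≤-Reasoning
      lemma : ∀ a e → a + e + e + e ≡ a + 3 * e
      lemma = solve-∀
      r< : a + e + toℕ i < a + 3 * e
      r< = begin-strict
        a + e + toℕ i   <⟨ ℕₚ.+-monoʳ-< (a + e) (Finₚ.toℕ<n i) ⟩
        a + e + e       ≤⟨ ℕₚ.m≤m+n _ e ⟩
        a + e + e + e   ≡⟨ lemma a e ⟩
        a + 3 * e       ∎
    -- Strictness is what allows cancelling `4 * E * e`, which is 0 when `E = 0`.
    ... | no ¬cheap = inj₂ (ℕₚ.<⇒≤ (ℕₚ.*-cancelˡ-< (4 * E * e) _ _ (begin-strict
      4 * E * e * (2 * vol a)                                       ≡⟨ lemma (4 * E) e (vol a) ⟩
      e * (4 * E * vol a) + 4 * E * e * vol a                       <⟨ ℕₚ.+-monoˡ-< (4 * E * e * vol a) expensive ⟩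
      sum< e (λ i → cost (a + e + i)) + 4 * E * e * vol a           ≤⟨ block-cost a ⟩
      4 * E * e * vol (a + 3 * e)                                   ∎)))
      where
      open ≤-Reasoning
      lemma : ∀ k e v → k * e * (2 * v) ≡ e * (k * v) + k * e * v
      lemma = solve-∀
      expensive : e * (4 * E * vol a) < sum< e (λ i → cost (a + e + i))
      expensive = begin-strict
        e * (4 * E * vol a)        <⟨ ℕₚ.*-monoʳ-< e {{ℕₚ.m^n≢0 2 E}} (ℕₚ.n<1+n _) ⟩
        e * suc (4 * E * vol a)    ≤⟨ sum-const-≤ e _ (λ i → cost (a + e + toℕ i)) (λ i →
          ℕₚ.≤-<-trans (ℕₚ.*-monoʳ-≤ (4 * E) (vol-mono (ℕₚ.≤-trans (ℕₚ.m≤m+n a e) (ℕₚ.m≤m+n _ (toℕ i)))))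
            (ℕₚ.≰⇒> (λ cheap → ¬cheap (i , cheap)))) ⟩
        sum< e (λ i → cost (a + e + i)) ∎

    cheap-or-grow : ∀ j a → (∃[ r ] (a ≤ r × r < a + j * (3 * e) × Cheap r)) ⊎
                            2 ^ j * vol a ≤ vol (a + j * (3 * e))
    cheap-or-grow zero    a = inj₂ (ℕₚ.≤-reflexive (≡.trans (ℕₚ.*-identityˡ _) (cong vol (≡.sym (ℕₚ.+-identityʳ a)))))
    cheap-or-grow (suc j) a with cheap-or-double a
    ... | inj₁ (r , a≤r , r< , cheap) =
      inj₁ (r , a≤r , ℕₚ.<-≤-trans r< (ℕₚ.+-monoʳ-≤ a (ℕₚ.m≤m+n (3 * e) _)) , cheap)
    ... | inj₂ double with cheap-or-grow j (a + 3 * e)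
    ...   | inj₁ (r , a≤r , r< , cheap) =
      inj₁ (r , ℕₚ.≤-trans (ℕₚ.m≤m+n a _) a≤r , subst (r <_) (ℕₚ.+-assoc a (3 * e) _) r< , cheap)
    ...   | inj₂ grow = inj₂ (begin
      2 * 2 ^ j * vol a               ≡⟨ lemma (2 ^ j) (vol a) ⟩
      2 ^ j * (2 * vol a)             ≤⟨ ℕₚ.*-monoʳ-≤ (2 ^ j) double ⟩
      2 ^ j * vol (a + 3 * e)         ≤⟨ grow ⟩
      vol (a + 3 * e + j * (3 * e))   ≡⟨ cong vol (ℕₚ.+-assoc a (3 * e) _) ⟩
      vol (a + suc j * (3 * e))       ∎)
      where
      open ≤-Reasoning
      lemma : ∀ x v → 2 * x * v ≡ x * (2 * v)
      lemma = solve-∀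

    -- `r≥` places `u` in its own ball, so that each carving step removes a vertex; `r<` keeps the
    -- ball below the truncation, so that its distances are realised by walks.
    record CheapCut : Set where
      field
        r       : ℕ
        r≥      : e ≤ r
        r<      : r < radius
        pay     : Fin n → ℕ
        covered : ∀ v → Cut r v → e ≤ wt (cov? v) pay
        cheap   : sum pay ≤ 4 * E * vol r

    -- If the ball of radius `J * e + e` has volume below `J * e`, then `D≤vol` leaves no vertex
    -- with distance strictly between `J * e` and `J * e + e`; cut vertices at radius `J * e` would
    -- lie there, so the cut is empty. Otherwise the volume starts at `J * e` at least, and `J`
    -- doublings would exceed the total weight.
    cheapCut : 1 ≤ J → sum m < 2 ^ J * (J * e) → (∀ v → v ∈ A → w v < e) → CheapCut
    cheapCut 1≤J small light with vol (J * e + e) <? J * e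
    ... | yes v< = record
      { r = J * e ; r≥ = e≤Je
      ; r< = ℕₚ.≤-<-trans (ℕₚ.m≤m+n _ _) 2Je<
      ; pay = λ _ → 0
      ; covered = λ v (v∈A , r<D , D≤) →
          let D< = ℕₚ.≤-<-trans D≤ (ℕₚ.+-monoʳ-< (J * e) (light v v∈A))
              D<R = ℕₚ.<-trans D< (ℕₚ.≤-<-trans (ℕₚ.+-monoʳ-≤ (J * e) e≤Je) 2Je<)
          in contradiction (ℕₚ.<-trans r<D (ℕₚ.≤-<-trans (D≤vol D<R) (ℕₚ.≤-<-trans (vol-mono (ℕₚ.<⇒≤ D<)) v<))) (ℕₚ.<-irrefl refl)
      ; cheap = ℕₚ.≤-trans (ℕₚ.≤-reflexive (sum-zero {n} (λ _ → 0) (λ _ → refl))) z≤n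
      }
      where
      e≤Je : e ≤ J * e
      e≤Je = ℕₚ.m≤n*m e J {{>-nonZero 1≤J}}
      Je>0 : 0 < J * e
      Je>0 = ℕₚ.<-≤-trans (ℕₚ.m^n>0 2 E) e≤Je
      2Je< : J * e + J * e < radius
      2Je< = ℕₚ.+-monoʳ-< (J * e) (ℕₚ.m<m+n (J * e) (ℕₚ.<-≤-trans Je>0 (ℕₚ.m≤m+n (J * e) _)))
    ... | no v≮ with cheap-or-grow J (J * e + e)
    ...   | inj₂ grow = contradiction (begin-strict
        sum m                                 <⟨ small ⟩
        2 ^ J * (J * e)                       ≤⟨ ℕₚ.*-monoʳ-≤ (2 ^ J) (ℕₚ.≮⇒≥ v≮) ⟩
        2 ^ J * vol (J * e + e)               ≤⟨ grow ⟩
        vol (J * e + e + J * (3 * e))         ≤⟨ wt≤sum (vol? _) m ⟩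
        sum m                                 ∎) (ℕₚ.<-irrefl refl)
      where open ≤-Reasoning
    ...   | inj₁ (r , a≤r , r< , cheap) = record
      { r = r ; r≥ = ℕₚ.≤-trans (ℕₚ.m≤n+m e (J * e)) a≤r
      ; r< = ℕₚ.<-≤-trans r< (begin
          J * e + e + J * (3 * e)
            ≤⟨ ℕₚ.+-monoˡ-≤ (J * (3 * e)) (ℕₚ.+-monoʳ-≤ (J * e) (ℕₚ.m≤n*m e J {{>-nonZero 1≤J}})) ⟩
          J * e + J * e + J * (3 * e)   ≡⟨ lemma J e ⟩
          radius                        ∎)
      ; pay = price r ; covered = cut-covered light r ; cheap = cheap }
      where
      open ≤-Reasoning
      lemma : ∀ J e → J * e + J * e + J * (3 * e) ≡ 5 * (J * e)
      lemma = solve-∀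

  -- Carving balls and adding the heavy vertices

  module Separator (1≤J : 1 ≤ J) (small : sum m < 2 ^ J * (J * e)) (X : Subset n) where

    Outside : Subset n → Subset n → Fin n → Set
    Outside A Z v = v ∈ A × v ∉ Z

    -- `u` need not be connected to `a` under `P`: the spreading constraint of any one vertex of `X`
    -- limits how many vertices of `X` are near it. The first alternative serves pieces without
    -- vertices of `X`, from which no ball is grown.
    Local : (Fin n → Set) → Set
    Local P = ∀ a → (∀ y → y ∈ X → ¬ Walk P a y) ⊎ ∃[ u ] (u ∈ X × (∀ y → Walk P a y → Close u y))

    Carved : Subset n → Set
    Carved A = ∃[ Z ] ∃[ pay ] (DownwardClosed Z × (∀ v → v ∈ Z → e ≤ wt (cov? v) pay) ×
                 sum pay ≤ 4 * E * wt (centerIn? A) m × Local (Outside A Z))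

    module CarveStep (A : Subset n) (up : UpwardClosed A) (light : ∀ v → v ∈ A → w v < e)
                     (u : Fin n) (u∈X : u ∈ X) (u∈A : u ∈ A) (cheapCut : Ball.CheapCut A up u) where
      open Ball A up u hiding (cheapCut)
      open CheapCut cheapCut

      Below : Fin n → Set
      Below v = ∃[ s ] (Cut r s × T (desc s v))

      below? : ∀ v → Dec (Below v)
      below? v = Finₚ.any? (λ s → cut? r s ×-dec T? (desc s v))

      Rest : Fin n → Set
      Rest v = v ∈ A × ¬ (D v ≤ r) × ¬ Below v

      rest? : ∀ v → Dec (Rest v)
      rest? v = (v Subₚ.∈? A) ×-dec ¬? (D v ≤? r) ×-dec ¬? (below? v)

      rest : Subset n
      rest = comprehension rest?

      cut⇒below : ∀ {v} → Cut r v → Below v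
      cut⇒below {v} cut = v , cut , Equivalence.from (desc⇔ v v) here

      below-down : ∀ {a v} → Below a → Desc a v → Below v
      below-down {a} {v} (s , cut , d) d′ =
        s , cut , Equivalence.from (desc⇔ s v) (desc-trans (Equivalence.to (desc⇔ s a) d) d′)

      -- An ancestor `a` of `v` inside the ball gives `D v ≤ r + w v` by `D-down`. Then `v`, being
      -- outside the ball, would be a cut vertex.
      rest-up : UpwardClosed rest
      rest-up {a} {v} d v∈ with ∈-comprehension⁻ rest? v∈
      ... | v∈A , D≰r , ¬below = ∈-comprehension⁺ rest?
        ( up d v∈A
        , (λ Da≤r → ¬below (cut⇒below
            (v∈A , ℕₚ.≰⇒> D≰r , ℕₚ.≤-trans (D-down v∈A d) (ℕₚ.+-monoˡ-≤ (w v) Da≤r))))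
        , λ below → ¬below (below-down below d))

      rest⊆A : ∀ {v} → v ∈ rest → v ∈ A
      rest⊆A = proj₁ ∘ ∈-comprehension⁻ rest?

      Du≤r : D u ≤ r
      Du≤r = ℕₚ.≤-trans (D-minimal (F , bound , here (u∈A , λ c → ∈-comprehension⁺ (cov? u))))
               (ℕₚ.≤-trans (ℕₚ.<⇒≤ (light u u∈A)) r≥)
        where
        F : Subset n
        F = comprehension (cov? u)
        bound : wt (Subₚ._∈? F) m ≤ w u
        bound = wt-mono (Subₚ._∈? F) (cov? u) m (λ c → ∈-comprehension⁻ (cov? u))

      rest<A : size rest < size A
      rest<A = Subₚ.p⊂q⇒∣p∣<∣q∣ (rest⊆A , u , u∈A , λ u∈ → proj₁ (proj₂ (∈-comprehension⁻ rest? u∈)) Du≤r)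

      crossing-cut : ∀ {a b} → b ∈ A → T (adj G a b) → D a ≤ r → ¬ (D b ≤ r) → Below b
      crossing-cut {a} {b} b∈A ab Da≤r Db≰r =
        cut⇒below (b∈A , ℕₚ.≰⇒> Db≰r , ℕₚ.≤-trans (D-edge b∈A ab) (ℕₚ.+-monoˡ-≤ (w b) Da≤r))

      stay-in-ball : ∀ {a y} → Walk (λ v → v ∈ A × ¬ Below v) a y → D a ≤ r → D y ≤ r
      stay-in-ball (here _) Da≤r = Da≤r
      stay-in-ball (there {b = b} _ ab W) Da≤r with D b ≤? r
      ... | yes Db≤r = stay-in-ball W Db≤r
      ... | no Db≰r  = contradiction (crossing-cut (proj₁ (walk-start W)) ab Da≤r Db≰r) (proj₂ (walk-start W))

      stay-in-rest : ∀ {Z a y} → Walk (λ v → (v ∈ A × ¬ Below v) × v ∉ Z) a y → ¬ (D a ≤ r) →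
                     Walk (Outside rest Z) a y
      stay-in-rest (here ((a∈A , ¬below) , a∉Z)) Da≰r = here (∈-comprehension⁺ rest? (a∈A , Da≰r , ¬below) , a∉Z)
      stay-in-rest (there {b = b} ((a∈A , ¬below) , a∉Z) ab W) Da≰r with D b ≤? r
      -- Read backwards, the edge leaves the ball at `a` and makes `a` a cut vertex.
      ... | yes Db≤r = contradiction (crossing-cut a∈A (adj-sym ab) Db≤r Da≰r) ¬below
      ... | no Db≰r  = there (∈-comprehension⁺ rest? (a∈A , Da≰r , ¬below) , a∉Z) ab (stay-in-rest W Db≰r)

      D≤r⇒close : ∀ {y} → D y ≤ r → Close u y
      D≤r⇒close {y} Dy≤r with D-reach {y} (ℕₚ.≤-<-trans Dy≤r r<)
      ... | F , wt≤ , W = F , ℕₚ.≤-trans wt≤ (ℕₚ.≤-trans Dy≤r (ℕₚ.<⇒≤ r<)) , walk-map proj₂ W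

      combine : Carved rest → Carved A
      combine (Z , pay′ , down , covered′ , cheap′ , local) =
        S , (λ c → pay c + pay′ c) , S-down , S-covered , S-cheap , S-local
        where
        S? : ∀ v → Dec (Below v ⊎ v ∈ Z)
        S? v = below? v ⊎-dec (v Subₚ.∈? Z)
        S : Subset n
        S = comprehension S?
        S-down : DownwardClosed S
        S-down a v a∈S d with ∈-comprehension⁻ S? a∈S
        ... | inj₁ below = ∈-comprehension⁺ S? (inj₁ (below-down below d))
        ... | inj₂ a∈Z   = ∈-comprehension⁺ S? (inj₂ (down a v a∈Z d))
        S-covered : ∀ v → v ∈ S → e ≤ wt (cov? v) (λ c → pay c + pay′ c)
        S-covered v v∈S with ∈-comprehension⁻ S? v∈S
        ... | inj₁ (s , cut , d) = ℕₚ.≤-trans (covered s cut)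
                (ℕₚ.≤-trans (wt-mono (cov? s) (cov? v) pay (λ c → cov-down (Equivalence.to (desc⇔ s v) d)))
                            (wt-monoᶠ (cov? v) (λ c → ℕₚ.m≤m+n (pay c) (pay′ c))))
        ... | inj₂ v∈Z = ℕₚ.≤-trans (covered′ v v∈Z) (wt-monoᶠ (cov? v) (λ c → ℕₚ.m≤n+m (pay′ c) (pay c)))
        S-cheap : sum (λ c → pay c + pay′ c) ≤ 4 * E * wt (centerIn? A) m
        S-cheap = begin
          sum (λ c → pay c + pay′ c)                           ≡⟨ ∑-distrib-+ {n} pay pay′ ⟩
          sum pay + sum pay′                                   ≤⟨ ℕₚ.+-mono-≤ cheap cheap′ ⟩
          4 * E * vol r + 4 * E * wt (centerIn? rest) m        ≡⟨ ℕₚ.*-distribˡ-+ (4 * E) (vol r) _ ⟨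
          4 * E * (vol r + wt (centerIn? rest) m)              ≤⟨ ℕₚ.*-monoʳ-≤ (4 * E)
            (wt-disjoint-≤ (vol? r) (centerIn? rest) (centerIn? A) m (λ c → proj₁)
              (λ c (center , c∈) → center , rest⊆A c∈)
              (λ c (_ , D≤r) (_ , c∈) → proj₁ (proj₂ (∈-comprehension⁻ rest? c∈)) D≤r)) ⟩
          4 * E * wt (centerIn? A) m                           ∎
          where open ≤-Reasoning
        split : ∀ {v} → Outside A S v → (v ∈ A × ¬ Below v) × v ∉ Z
        split (v∈A , v∉S) = (v∈A , v∉S ∘ ∈-comprehension⁺ S? ∘ inj₁) , v∉S ∘ ∈-comprehension⁺ S? ∘ inj₂
        S-local : Local (Outside A S)
        S-local a = [ in-ball , in-rest ]′ (Dec.toSum (D a ≤? r))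
          where
          in-ball : D a ≤ r → _
          in-ball Da≤r = inj₂ (u , u∈X , λ y W → D≤r⇒close (stay-in-ball (walk-map (proj₁ ∘ split) W) Da≤r))
          in-rest : ¬ (D a ≤ r) → _
          in-rest Da≰r = Sum.map
            (λ none y y∈X W → none y y∈X (stay-in-rest (walk-map split W) Da≰r))
            (λ (u′ , u′∈X , close) → u′ , u′∈X , λ y W → close y (stay-in-rest (walk-map split W) Da≰r))
            (local a)

    carve : ∀ k (A : Subset n) → size A < k → UpwardClosed A → (∀ v → v ∈ A → w v < e) → Carved A
    carve (suc k) A (s≤s A≤k) up light = [ step , stop ]′ (Dec.toSum (Finₚ.any? (λ u → u Subₚ.∈? X ×-dec u Subₚ.∈? A)))
      where
      step : ∃[ u ] (u ∈ X × u ∈ A) → Carved A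
      step (u , u∈X , u∈A) = combine (carve k rest (ℕₚ.<-≤-trans rest<A A≤k) rest-up (λ v → light v ∘ rest⊆A))
        where open CarveStep A up light u u∈X u∈A (Ball.cheapCut A up u 1≤J small light)
      stop : ¬ (∃[ u ] (u ∈ X × u ∈ A)) → Carved A
      stop ¬u = ∅ , (λ _ → 0) , (λ a v a∈ → contradiction a∈ Subₚ.∉⊥) , (λ v v∈ → contradiction v∈ Subₚ.∉⊥) ,
        ℕₚ.≤-trans (ℕₚ.≤-reflexive (sum-zero {n} (λ _ → 0) (λ _ → refl))) z≤n ,
        λ a → inj₁ (λ y y∈X W → ¬u (y , y∈X , proj₁ (walk-end W)))

    Separation : Set
    Separation = ∃[ S ] ∃[ pay ] (DownwardClosed S × (∀ v → v ∈ S → e ≤ wt (cov? v) pay) ×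
                   sum pay ≤ (4 * E + 1) * sum m × Local (_∉ S))

    light? : ∀ v → Dec (w v < e)
    light? v = w v <? e

    lightSet : Subset n
    lightSet = comprehension light?

    light-up : UpwardClosed lightSet
    light-up {a} {v} d v∈A = ∈-comprehension⁺ light?
      (ℕₚ.≤-<-trans (wt-mono (cov? a) (cov? v) m (λ c → cov-down d)) (∈-comprehension⁻ light? v∈A))

    -- On heavy vertices the weights `m` are already a cover at scale `e`; they account for the 1 in
    -- `4 * E + 1`. Since `w` grows along descents, the heavy set is downward closed.
    add-heavy : Carved lightSet → Separation
    add-heavy (Z , pay , down , covered , cheap , local) =
        S , (λ c → m c + pay c) , S-down , S-covered , S-cheap , S-local
      where
      S? : ∀ v → Dec (e ≤ w v ⊎ v ∈ Z)
      S? v = (e ≤? w v) ⊎-dec (v Subₚ.∈? Z)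
      S : Subset n
      S = comprehension S?
      S-down : DownwardClosed S
      S-down a v a∈S d with ∈-comprehension⁻ S? a∈S
      ... | inj₁ heavy = ∈-comprehension⁺ S? (inj₁ (ℕₚ.≤-trans heavy (wt-mono (cov? a) (cov? v) m (λ c → cov-down d))))
      ... | inj₂ a∈Z   = ∈-comprehension⁺ S? (inj₂ (down a v a∈Z d))
      S-covered : ∀ v → v ∈ S → e ≤ wt (cov? v) (λ c → m c + pay c)
      S-covered v v∈S with ∈-comprehension⁻ S? v∈S
      ... | inj₁ heavy = ℕₚ.≤-trans heavy (wt-monoᶠ (cov? v) (λ c → ℕₚ.m≤m+n (m c) (pay c)))
      ... | inj₂ v∈Z   = ℕₚ.≤-trans (covered v v∈Z) (wt-monoᶠ (cov? v) (λ c → ℕₚ.m≤n+m (pay c) (m c)))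
      S-cheap : sum (λ c → m c + pay c) ≤ (4 * E + 1) * sum m
      S-cheap = begin
        sum (λ c → m c + pay c)             ≡⟨ ∑-distrib-+ {n} m pay ⟩
        sum m + sum pay                     ≤⟨ ℕₚ.+-monoʳ-≤ (sum m) (ℕₚ.≤-trans cheap
                                                 (ℕₚ.*-monoʳ-≤ (4 * E) (wt≤sum (centerIn? _) m))) ⟩
        sum m + 4 * E * sum m               ≡⟨ lemma (4 * E) (sum m) ⟩
        (4 * E + 1) * sum m                 ∎
        where
        open ≤-Reasoning
        lemma : ∀ k s → s + k * s ≡ (k + 1) * s
        lemma = solve-∀
      split : ∀ {v} → v ∉ S → Outside lightSet Z v
      split v∉S = ∈-comprehension⁺ light? (ℕₚ.≰⇒> (v∉S ∘ ∈-comprehension⁺ S? ∘ inj₁)) , v∉S ∘ ∈-comprehension⁺ S? ∘ inj₂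
      S-local : Local (_∉ S)
      S-local a with local a
      ... | inj₁ none = inj₁ (λ y y∈X W → none y y∈X (walk-map split W))
      ... | inj₂ (u , u∈X , close) = inj₂ (u , u∈X , λ y W → close y (walk-map split W))

    separator : Separation
    separator = add-heavy (carve (suc (size lightSet)) lightSet ℕₚ.≤-refl light-up (λ v → ∈-comprehension⁻ light?))

-- Linear programs over ℚ

∑-cong : ∀ {n} {f g : Fin n → ℚ} → (∀ i → f i ≡ g i) → ∑ f ≡ ∑ g
∑-cong {zero}  f≡g = refl
∑-cong {suc n} f≡g = cong₂ ℚ._+_ (f≡g zero) (∑-cong (f≡g ∘ suc))

∑-mono : ∀ {n} {f g : Fin n → ℚ} → (∀ i → f i ℚ.≤ g i) → ∑ f ℚ.≤ ∑ g
∑-mono {zero}  f≤g = ℚₚ.≤-refl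
∑-mono {suc n} f≤g = ℚₚ.+-mono-≤ (f≤g zero) (∑-mono (f≤g ∘ suc))

∑-zero : ∀ n → ∑ {n} (λ _ → 0ℚ) ≡ 0ℚ
∑-zero zero    = refl
∑-zero (suc n) = ≡.trans (ℚₚ.+-identityˡ _) (∑-zero n)

∑-nonneg : ∀ {n} {f : Fin n → ℚ} → (∀ i → 0ℚ ℚ.≤ f i) → 0ℚ ℚ.≤ ∑ f
∑-nonneg {n} {f} 0≤f = subst (ℚ._≤ ∑ f) (∑-zero n) (∑-mono 0≤f)

*-distribˡ-∑ : ∀ {n} k (f : Fin n → ℚ) → k ℚ.* ∑ f ≡ ∑ (λ i → k ℚ.* f i)
*-distribˡ-∑ {zero}  k f = ℚₚ.*-zeroʳ k
*-distribˡ-∑ {suc n} k f = ≡.trans (ℚₚ.*-distribˡ-+ k (f zero) _) (cong (k ℚ.* f zero ℚ.+_) (*-distribˡ-∑ k (f ∘ suc)))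

∑-distrib-+ℚ : ∀ {n} (f g : Fin n → ℚ) → ∑ (λ i → f i ℚ.+ g i) ≡ ∑ f ℚ.+ ∑ g
∑-distrib-+ℚ {zero}  f g = refl
∑-distrib-+ℚ {suc n} f g = ≡.trans (cong (f zero ℚ.+ g zero ℚ.+_) (∑-distrib-+ℚ (f ∘ suc) (g ∘ suc)))
  (solve 4 (λ a b c d → a :+ b :+ (c :+ d) := a :+ c :+ (b :+ d)) refl (f zero) (g zero) (∑ (f ∘ suc)) (∑ (g ∘ suc)))
  where open +-*-Solver

∑[]-mono : ∀ {n} (b b′ : Fin n → Bool) {f g : Fin n → ℚ} → (∀ i → 0ℚ ℚ.≤ g i) →
           (∀ i → T (b i) → T (b′ i) × f i ℚ.≤ g i) → ∑[ b ] f ℚ.≤ ∑[ b′ ] g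
∑[]-mono b b′ {f} {g} 0≤g le = ∑-mono pointwise
  where
  pointwise : ∀ i → (if b i then f i else 0ℚ) ℚ.≤ (if b′ i then g i else 0ℚ)
  pointwise i with b i | b′ i | le i
  ... | true  | true  | h = proj₂ (h _)
  ... | true  | false | h = contradiction (proj₁ (h _)) id
  ... | false | true  | _ = 0≤g i
  ... | false | false | _ = ℚₚ.≤-refl

*-distribˡ-∑[] : ∀ {n} (b : Fin n → Bool) k (f : Fin n → ℚ) → k ℚ.* ∑[ b ] f ≡ ∑[ b ] (λ i → k ℚ.* f i)
*-distribˡ-∑[] {n} b k f = ≡.trans (*-distribˡ-∑ {n} k _) (∑-cong pointwise)
  where
  pointwise : ∀ i → k ℚ.* (if b i then f i else 0ℚ) ≡ (if b i then k ℚ.* f i else 0ℚ)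
  pointwise i with b i
  ... | true  = refl
  ... | false = ℚₚ.*-zeroʳ k

∑[]-nonneg : ∀ {n} (b : Fin n → Bool) {y : Fin n → ℚ} → (∀ i → 0ℚ ℚ.≤ y i) → 0ℚ ℚ.≤ ∑[ b ] y
∑[]-nonneg b {y} 0≤y = ∑-nonneg pointwise
  where
  pointwise : ∀ i → 0ℚ ℚ.≤ (if b i then y i else 0ℚ)
  pointwise i with b i
  ... | true  = 0≤y i
  ... | false = ℚₚ.≤-refl

-- An affine form: the coefficients of the variables followed by the constant term.
Affine : ℕ → Set
Affine n = Vec ℚ (suc n)

eval : ∀ {n} → Affine n → Vec ℚ n → ℚ
eval (b ∷ [])       []      = b
eval (a ∷ f@(_ ∷ _)) (t ∷ y) = a ℚ.* t ℚ.+ eval f y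

scale : ∀ {n} → ℚ → Affine n → Affine n
scale k = Vec.map (k ℚ.*_)

eval-scale : ∀ {n} k (f : Affine n) y → eval (scale k f) y ≡ k ℚ.* eval f y
eval-scale k (b ∷ [])        []      = refl
eval-scale k (a ∷ f@(_ ∷ _)) (t ∷ y) = ≡.trans (cong (k ℚ.* a ℚ.* t ℚ.+_) (eval-scale k f y))
  (solve 4 (λ k a t r → k :* a :* t :+ k :* r := k :* (a :* t :+ r)) refl k a t (eval f y))
  where open +-*-Solver

_⊝_ : ∀ {n} → Affine n → Affine n → Affine n
f ⊝ g = Vec.zipWith ℚ._-_ f g

eval-⊝ : ∀ {n} (f g : Affine n) y → eval (f ⊝ g) y ≡ eval f y ℚ.- eval g y
eval-⊝ (b ∷ [])        (c ∷ [])        []      = refl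
eval-⊝ (a ∷ f@(_ ∷ _)) (b ∷ g@(_ ∷ _)) (t ∷ y) =
  ≡.trans (cong ((a ℚ.- b) ℚ.* t ℚ.+_) (eval-⊝ f g y))
  (solve 5 (λ a b t r s → (a :- b) :* t :+ (r :- s) := (a :* t :+ r) :- (b :* t :+ s)) refl a b t (eval f y) (eval g y))
  where open +-*-Solver

Sat : ∀ {n} → List (Affine n) → Vec ℚ n → Set
Sat cs y = All (λ f → 0ℚ ℚ.≤ eval f y) cs

p≤q⇒0≤q-p : ∀ {p q} → p ℚ.≤ q → 0ℚ ℚ.≤ q ℚ.- p
p≤q⇒0≤q-p {p} {q} p≤q = subst (ℚ._≤ q ℚ.- p) (ℚₚ.+-inverseʳ p) (ℚₚ.+-monoˡ-≤ (ℚ.- p) p≤q)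

0≤q-p⇒p≤q : ∀ {p q} → 0ℚ ℚ.≤ q ℚ.- p → p ℚ.≤ q
0≤q-p⇒p≤q {p} {q} 0≤ = subst₂ ℚ._≤_ (ℚₚ.+-identityˡ p) (solve 2 (λ p q → (q :- p) :+ p := q) refl p q) (ℚₚ.+-monoˡ-≤ p 0≤)
  where open +-*-Solver

module _ (a i t ρ : ℚ) (a*i≡1 : a ℚ.* i ≡ 1ℚ) where
  open +-*-Solver

  private
    expand : i ℚ.* (a ℚ.* t ℚ.+ ρ) ≡ t ℚ.- (ℚ.- i) ℚ.* ρ
    expand = ≡.trans
      (solve 4 (λ a i t r → i :* (a :* t :+ r) := (a :* i) :* t :- (:- i) :* r) refl a i t ρ)
      (≡.trans (cong (λ z → z ℚ.* t ℚ.- (ℚ.- i) ℚ.* ρ) a*i≡1) (cong (ℚ._- (ℚ.- i) ℚ.* ρ) (ℚₚ.*-identityˡ t)))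

    contract : a ℚ.* (t ℚ.- (ℚ.- i) ℚ.* ρ) ≡ a ℚ.* t ℚ.+ ρ
    contract = ≡.trans
      (solve 4 (λ a i t r → a :* (t :- (:- i) :* r) := a :* t :+ (a :* i) :* r) refl a i t ρ)
      (cong (a ℚ.* t ℚ.+_) (≡.trans (cong (ℚ._* ρ) a*i≡1) (ℚₚ.*-identityˡ ρ)))

  lower⁺ : .{{_ : ℚ.Positive i}} → 0ℚ ℚ.≤ a ℚ.* t ℚ.+ ρ → (ℚ.- i) ℚ.* ρ ℚ.≤ t
  lower⁺ 0≤ = 0≤q-p⇒p≤q (subst₂ ℚ._≤_ (ℚₚ.*-zeroʳ i) expand (ℚₚ.*-monoˡ-≤-nonNeg i {{ℚₚ.pos⇒nonNeg i}} 0≤))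

  lower⁻ : .{{_ : ℚ.Positive a}} → (ℚ.- i) ℚ.* ρ ℚ.≤ t → 0ℚ ℚ.≤ a ℚ.* t ℚ.+ ρ
  lower⁻ l≤t = subst₂ ℚ._≤_ (ℚₚ.*-zeroʳ a) contract (ℚₚ.*-monoˡ-≤-nonNeg a {{ℚₚ.pos⇒nonNeg a}} (p≤q⇒0≤q-p l≤t))

  private
    flip : ∀ p q → ℚ.- (p ℚ.- q) ≡ q ℚ.- p
    flip = solve 2 (λ p q → :- (p :- q) := q :- p) refl

  upper⁺ : .{{_ : ℚ.Negative i}} → 0ℚ ℚ.≤ a ℚ.* t ℚ.+ ρ → t ℚ.≤ (ℚ.- i) ℚ.* ρ
  upper⁺ 0≤ = 0≤q-p⇒p≤q (subst (0ℚ ℚ.≤_) (flip t ((ℚ.- i) ℚ.* ρ)) (ℚₚ.neg-antimono-≤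
    (subst₂ ℚ._≤_ expand (ℚₚ.*-zeroʳ i) (ℚₚ.*-monoˡ-≤-nonPos i {{ℚₚ.neg⇒nonPos i}} 0≤))))

  upper⁻ : .{{_ : ℚ.Negative a}} → t ℚ.≤ (ℚ.- i) ℚ.* ρ → 0ℚ ℚ.≤ a ℚ.* t ℚ.+ ρ
  upper⁻ t≤u = subst₂ ℚ._≤_ (ℚₚ.*-zeroʳ a) contract (ℚₚ.*-monoˡ-≤-nonPos a {{ℚₚ.neg⇒nonPos a}}
    (subst (ℚ._≤ 0ℚ) (flip ((ℚ.- i) ℚ.* ρ) t) (ℚₚ.neg-antimono-≤ (p≤q⇒0≤q-p t≤u))))

-- Eliminating variables from affine systems

-- Constraints are sorted by the sign of the leading coefficient and solved for the first variable;
-- those with coefficient 0 are `free`.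
record Bounds {n : ℕ} (cs : List (Affine (suc n))) : Set where
  field
    lower upper free : List (Affine n)

  Within : ℚ → Vec ℚ n → Set
  Within t y = All (λ f → eval f y ℚ.≤ t) lower × All (λ f → t ℚ.≤ eval f y) upper × Sat free y

  field
    to   : ∀ t y → Sat cs (t ∷ y) → Within t y
    from : ∀ t y → Within t y → Sat cs (t ∷ y)

bounds : ∀ {n} (cs : List (Affine (suc n))) → Bounds cs
bounds [] = record { lower = [] ; upper = [] ; free = [] ; to = λ _ _ _ → [] , [] , [] ; from = λ _ _ _ → [] }
bounds ((a ∷ f@(_ ∷ _)) ∷ cs) with bounds cs | ℚₚ.<-cmp a 0ℚ
... | record { lower = L ; upper = U ; free = Z ; to = to ; from = from } | tri≈ _ refl _ = record
  { lower = L ; upper = U ; free = f ∷ Z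
  ; to   = λ { t y (s ∷ ss) → let l , u , z = to t y ss in l , u , subst (0ℚ ℚ.≤_) (drop t y) s ∷ z }
  ; from = λ { t y (l , u , s ∷ z) → subst (0ℚ ℚ.≤_) (≡.sym (drop t y)) s ∷ from t y (l , u , z) }
  }
  where
  drop : ∀ t y → 0ℚ ℚ.* t ℚ.+ eval f y ≡ eval f y
  drop t y = ≡.trans (cong (ℚ._+ eval f y) (ℚₚ.*-zeroˡ t)) (ℚₚ.+-identityˡ _)
... | record { lower = L ; upper = U ; free = Z ; to = to ; from = from } | tri> _ _ a>0 = record
  { lower = g ∷ L ; upper = U ; free = Z
  ; to   = λ { t y (s ∷ ss) → let l , u , z = to t y ss in
      subst (ℚ._≤ t) (≡.sym (eval-scale (ℚ.- i) f y)) (lower⁺ a i t (eval f y) inv s) ∷ l , u , z }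
  ; from = λ { t y (b ∷ l , u , z) →
      lower⁻ a i t (eval f y) inv (subst (ℚ._≤ t) (eval-scale (ℚ.- i) f y) b) ∷ from t y (l , u , z) }
  }
  where
  instance
    a-pos = ℚ.positive a>0
    a≢0   = ℚₚ.pos⇒nonZero a
    i-pos = ℚₚ.1/pos⇒pos a
  i = ℚ.1/ a
  inv = ℚₚ.*-inverseʳ a
  g = scale (ℚ.- i) f
... | record { lower = L ; upper = U ; free = Z ; to = to ; from = from } | tri< a<0 _ _ = record
  { lower = L ; upper = g ∷ U ; free = Z
  ; to   = λ { t y (s ∷ ss) → let l , u , z = to t y ss in
      l , subst (t ℚ.≤_) (≡.sym (eval-scale (ℚ.- i) f y)) (upper⁺ a i t (eval f y) inv s) ∷ u , z }
  ; from = λ { t y (l , b ∷ u , z) →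
      upper⁻ a i t (eval f y) inv (subst (t ℚ.≤_) (eval-scale (ℚ.- i) f y) b) ∷ from t y (l , u , z) }
  }
  where
  instance
    a-neg = ℚ.negative a<0
    a≢0   = ℚₚ.neg⇒nonZero a
    i-neg = ℚₚ.1/neg⇒neg a
  i = ℚ.1/ a
  inv = ℚₚ.*-inverseʳ a
  g = scale (ℚ.- i) f

-- The witness is the minimum of 0 and the upper bounds, raised to the largest lower bound where
-- necessary. The base 0 is arbitrary.
between : ∀ {A B : Set} (p : A → ℚ) (q : B → ℚ) (L : List A) (U : List B) →
          All (λ l → All (λ u → p l ℚ.≤ q u) U) L →
          ∃[ t ] (All (λ l → p l ℚ.≤ t) L × All (λ u → t ℚ.≤ q u) U)
between p q [] [] _ = 0ℚ , [] , []
between p q [] (u ∷ U) _ with between p q [] U []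
... | t , _ , t≤ = q u ℚ.⊓ t , [] , ℚₚ.p⊓q≤p (q u) t ∷ All.map (ℚₚ.≤-trans (ℚₚ.p⊓q≤q (q u) t)) t≤
between p q (l ∷ L) U (l≤ ∷ L≤) with between p q L U L≤
... | t , ≤t , t≤ = p l ℚ.⊔ t ,
  ℚₚ.p≤p⊔q (p l) t ∷ All.map (λ ≤t → ℚₚ.≤-trans ≤t (ℚₚ.p≤q⊔p (p l) t)) ≤t ,
  All.zipWith (λ (l≤ , t≤) → ℚₚ.⊔-lub l≤ t≤) (l≤ , t≤)

gaps : ∀ {n} → List (Affine n) → List (Affine n) → List (Affine n)
gaps []      U = []
gaps (l ∷ L) U = List.map (_⊝ l) U ++ gaps L U

module _ {n : ℕ} (y : Vec ℚ n) where

  gap⁺ : ∀ l U → All (λ u → eval l y ℚ.≤ eval u y) U → Sat (List.map (_⊝ l) U) y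
  gap⁺ l []      []         = []
  gap⁺ l (u ∷ U) (l≤u ∷ l≤) = subst (0ℚ ℚ.≤_) (≡.sym (eval-⊝ u l y)) (p≤q⇒0≤q-p l≤u) ∷ gap⁺ l U l≤

  gap⁻ : ∀ l U → Sat (List.map (_⊝ l) U) y → All (λ u → eval l y ℚ.≤ eval u y) U
  gap⁻ l []      []       = []
  gap⁻ l (u ∷ U) (s ∷ ss) = 0≤q-p⇒p≤q (subst (0ℚ ℚ.≤_) (eval-⊝ u l y) s) ∷ gap⁻ l U ss

  gaps⁺ : ∀ L U → All (λ l → All (λ u → eval l y ℚ.≤ eval u y) U) L → Sat (gaps L U) y
  gaps⁺ []      U []         = []
  gaps⁺ (l ∷ L) U (l≤ ∷ L≤) = Allₚ.++⁺ (gap⁺ l U l≤) (gaps⁺ L U L≤)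

  gaps⁻ : ∀ L U → Sat (gaps L U) y → All (λ l → All (λ u → eval l y ℚ.≤ eval u y) U) L
  gaps⁻ []      U _  = []
  gaps⁻ (l ∷ L) U ss = gap⁻ l U (Allₚ.++⁻ˡ (List.map (_⊝ l) U) ss) ∷ gaps⁻ L U (Allₚ.++⁻ʳ (List.map (_⊝ l) U) ss)

-- Fourier–Motzkin elimination.
eliminate : ∀ {n} {cs : List (Affine (suc n))} → Bounds cs →
            ∃[ ds ] ((∀ t y → Sat cs (t ∷ y) → Sat ds y) × (∀ y → Sat ds y → ∃[ t ] Sat cs (t ∷ y)))
eliminate {n} {cs} bs = free ++ gaps lower upper , sound , complete
  where
  open Bounds bs
  sound : ∀ t y → Sat cs (t ∷ y) → Sat (free ++ gaps lower upper) y
  sound t y s = let l≤t , t≤u , z = to t y s in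
    Allₚ.++⁺ z (gaps⁺ y lower upper (All.map (λ l≤t → All.map (ℚₚ.≤-trans l≤t) t≤u) l≤t))
  complete : ∀ y → Sat (free ++ gaps lower upper) y → ∃[ t ] Sat cs (t ∷ y)
  complete y s =
    let t , l≤t , t≤u = between (λ f → eval f y) (λ f → eval f y) lower upper
                          (gaps⁻ y lower upper (Allₚ.++⁻ʳ free s))
    in t , from t y (l≤t , t≤u , Allₚ.++⁻ˡ free s)

-- Variables are eliminated from the front, so the one to keep, the objective value, stands last.
project : ∀ n (cs : List (Affine (suc n))) →
          ∃[ ds ] ((∀ c y → Sat cs (y ∷ʳ c) → Sat ds (c ∷ [])) × (∀ c → Sat ds (c ∷ []) → ∃[ y ] Sat cs (y ∷ʳ c)))
project zero    cs = cs , (λ { c [] s → s }) , λ c s → [] , s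
project (suc n) cs with eliminate (bounds cs)
... | cs′ , sound , complete with project n cs′
...   | ds , sound′ , complete′ = ds , (λ { c (t ∷ y) s → sound′ c y (sound t (y ∷ʳ c) s) }) ,
  λ c s → let y , s′ = complete′ c s ; t , s″ = complete (y ∷ʳ c) s′ in t ∷ y , s″

-- Projected to the objective value, the system is an interval with non-strict bounds. The maximum
-- of 0 and its lower bounds is at most every feasible value, hence below the upper bounds, and is
-- attained.
minimum : ∀ {n} (cs : List (Affine (suc n))) → (∀ c y → Sat cs (y ∷ʳ c) → 0ℚ ℚ.≤ c) →
          ∀ c₀ y₀ → Sat cs (y₀ ∷ʳ c₀) →
          ∃[ c ] ∃[ y ] (Sat cs (y ∷ʳ c) × (∀ c′ y′ → Sat cs (y′ ∷ʳ c′) → c ℚ.≤ c′))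
minimum {n} cs nonneg c₀ y₀ s₀ with project n cs
... | ds , sound , complete = go (bounds ds)
  where
  go : Bounds ds → ∃[ c ] ∃[ y ] (Sat cs (y ∷ʳ c) × (∀ c′ y′ → Sat cs (y′ ∷ʳ c′) → c ℚ.≤ c′))
  go bs = c , proj₁ (complete c feasible) , proj₂ (complete c feasible) ,
        λ c′ y′ s → c-least c′ (nonneg c′ y′ s) (proj₁ (to c′ [] (sound c′ y′ s)))
    where
    open Bounds bs
    maximum : List (Affine 0) → ℚ
    maximum = foldr (λ f → eval f [] ℚ.⊔_) 0ℚ
    maximum-lub : ∀ fs t → 0ℚ ℚ.≤ t → All (λ f → eval f [] ℚ.≤ t) fs → maximum fs ℚ.≤ t
    maximum-lub []       t 0≤t []         = 0≤t
    maximum-lub (f ∷ fs) t 0≤t (f≤ ∷ fs≤) = ℚₚ.⊔-lub f≤ (maximum-lub fs t 0≤t fs≤)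
    maximum-upper : ∀ fs → All (λ f → eval f [] ℚ.≤ maximum fs) fs
    maximum-upper []       = []
    maximum-upper (f ∷ fs) = ℚₚ.p≤p⊔q (eval f []) _ ∷
      All.map (λ ≤m → ℚₚ.≤-trans ≤m (ℚₚ.p≤q⊔p (eval f []) _)) (maximum-upper fs)
    c : ℚ
    c = maximum lower
    c-least : ∀ c′ → 0ℚ ℚ.≤ c′ → All (λ f → eval f [] ℚ.≤ c′) lower → c ℚ.≤ c′
    c-least = maximum-lub lower
    feasible : Sat ds (c ∷ [])
    feasible with to c₀ [] (sound c₀ y₀ s₀)
    ... | l≤ , ≤u , z = from c [] (maximum-upper lower ,
      All.map (ℚₚ.≤-trans (c-least c₀ (nonneg c₀ y₀ s₀) l≤)) ≤u , z)

-- Rational linear programs attain their minimum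

⟪_,_⟫ : ∀ {n} → (Fin n → ℚ) → (Fin n → ℚ) → ℚ
⟪ a , y ⟫ = ∑ (λ i → a i ℚ.* y i)

row : ∀ {n} → (Fin n → ℚ) → ℚ → ℚ → Affine (suc n)
row {zero}  a γ β = γ ∷ β ∷ []
row {suc n} a γ β = a zero ∷ row (a ∘ suc) γ β

eval-∷ : ∀ {n} a (f : Affine n) t y → eval (a ∷ f) (t ∷ y) ≡ a ℚ.* t ℚ.+ eval f y
eval-∷ a (_ ∷ _) t y = refl

eval-row : ∀ {n} (a : Fin n → ℚ) γ β y c →
           eval (row a γ β) (y ∷ʳ c) ≡ ⟪ a , Vec.lookup y ⟫ ℚ.+ (γ ℚ.* c ℚ.+ β)
eval-row a γ β []      c = ≡.sym (ℚₚ.+-identityˡ _)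
eval-row a γ β (t ∷ y) c = ≡.trans (eval-∷ (a zero) (row (a ∘ suc) γ β) t (y ∷ʳ c))
  (≡.trans (cong (a zero ℚ.* t ℚ.+_) (eval-row (a ∘ suc) γ β y c)) (≡.sym (ℚₚ.+-assoc (a zero ℚ.* t) _ _)))

module LinearProgram {n : ℕ} (cs : List ((Fin n → ℚ) × ℚ)) (o : Fin n → ℚ) where
  open +-*-Solver

  Feasible : (Fin n → ℚ) → Set
  Feasible y = All (λ (a , b) → b ℚ.≤ ⟪ a , y ⟫) cs

  -- The epigraph form: the objective value is a new variable, bounded below by the objective.
  system : List (Affine (suc n))
  system = row (λ i → (ℚ.- 1ℚ) ℚ.* o i) 1ℚ 0ℚ ∷ List.map (λ (a , b) → row a 0ℚ (ℚ.- b)) cs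

  ⟪⟫-cong : ∀ a {y z : Fin n → ℚ} → (∀ i → y i ≡ z i) → ⟪ a , y ⟫ ≡ ⟪ a , z ⟫
  ⟪⟫-cong a y≡z = ∑-cong (λ i → cong (a i ℚ.*_) (y≡z i))

  constraint-row : ∀ (a : Fin n → ℚ) b (y : Vec ℚ n) c → eval (row a 0ℚ (ℚ.- b)) (y ∷ʳ c) ≡ ⟪ a , Vec.lookup y ⟫ ℚ.- b
  constraint-row a b y c = ≡.trans (eval-row a 0ℚ (ℚ.- b) y c)
    (cong (⟪ a , Vec.lookup y ⟫ ℚ.+_) (≡.trans (cong (ℚ._+ (ℚ.- b)) (ℚₚ.*-zeroˡ c)) (ℚₚ.+-identityˡ (ℚ.- b))))

  objective-row : ∀ y c → eval (row (λ i → (ℚ.- 1ℚ) ℚ.* o i) 1ℚ 0ℚ) (y ∷ʳ c) ≡ c ℚ.- ⟪ o , Vec.lookup y ⟫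
  objective-row y c = ≡.trans (eval-row _ 1ℚ 0ℚ y c) (≡.trans
    (cong (ℚ._+ (1ℚ ℚ.* c ℚ.+ 0ℚ)) (≡.trans
      (∑-cong (λ i → ℚₚ.*-assoc (ℚ.- 1ℚ) (o i) (Vec.lookup y i)))
      (≡.sym (*-distribˡ-∑ (ℚ.- 1ℚ) (λ i → o i ℚ.* Vec.lookup y i)))))
    (solve 2 (λ s c → (:- con 1ℚ) :* s :+ (con 1ℚ :* c :+ con 0ℚ) := c :- s) refl ⟪ o , Vec.lookup y ⟫ c))

  system⁺ : ∀ y c → Feasible (Vec.lookup y) → ⟪ o , Vec.lookup y ⟫ ℚ.≤ c → Sat system (y ∷ʳ c)
  system⁺ y c feas o≤c = subst (0ℚ ℚ.≤_) (≡.sym (objective-row y c)) (p≤q⇒0≤q-p o≤c) ∷ rows cs feas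
    where
    rows : ∀ cs → All (λ (a , b) → b ℚ.≤ ⟪ a , Vec.lookup y ⟫) cs → Sat (List.map (λ (a , b) → row a 0ℚ (ℚ.- b)) cs) (y ∷ʳ c)
    rows []             []       = []
    rows ((a , b) ∷ cs) (s ∷ ss) = subst (0ℚ ℚ.≤_) (≡.sym (constraint-row a b y c)) (p≤q⇒0≤q-p s) ∷ rows cs ss

  system⁻ : ∀ y c → Sat system (y ∷ʳ c) → Feasible (Vec.lookup y) × ⟪ o , Vec.lookup y ⟫ ℚ.≤ c
  system⁻ y c (s ∷ ss) = rows cs ss , 0≤q-p⇒p≤q (subst (0ℚ ℚ.≤_) (objective-row y c) s)
    where
    rows : ∀ cs → Sat (List.map (λ (a , b) → row a 0ℚ (ℚ.- b)) cs) (y ∷ʳ c) → All (λ (a , b) → b ℚ.≤ ⟪ a , Vec.lookup y ⟫) cs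
    rows []             []       = []
    rows ((a , b) ∷ cs) (s ∷ ss) = 0≤q-p⇒p≤q (subst (0ℚ ℚ.≤_) (constraint-row a b y c) s) ∷ rows cs ss

  feasible-point : ∀ y → Feasible y → Sat system (Vec.tabulate y ∷ʳ ⟪ o , y ⟫)
  feasible-point y feas = system⁺ (Vec.tabulate y) _
    (All.map (λ {(a , b)} → subst (b ℚ.≤_) (≡.sym (⟪⟫-cong a (Vecₚ.lookup∘tabulate y)))) feas)
    (ℚₚ.≤-reflexive (⟪⟫-cong o (Vecₚ.lookup∘tabulate y)))

  attained : (∀ y → Feasible y → 0ℚ ℚ.≤ ⟪ o , y ⟫) → ∀ y₀ → Feasible y₀ →
             ∃[ y ] (Feasible y × (∀ y′ → Feasible y′ → ⟪ o , y ⟫ ℚ.≤ ⟪ o , y′ ⟫))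
  attained nonneg y₀ feas₀ =
    let c , y , s , least = minimum system
          (λ c y s → ℚₚ.≤-trans (nonneg (Vec.lookup y) (proj₁ (system⁻ y c s))) (proj₂ (system⁻ y c s)))
          ⟪ o , y₀ ⟫ (Vec.tabulate y₀) (feasible-point y₀ feas₀)
    in Vec.lookup y , proj₁ (system⁻ y c s) ,
       λ y′ feas → ℚₚ.≤-trans (proj₂ (system⁻ y c s)) (least _ _ (feasible-point y′ feas))

indicator : Bool → ℚ
indicator b = if b then 1ℚ else 0ℚ

⟪indicator⟫ : ∀ {n} (b : Fin n → Bool) y → ⟪ indicator ∘ b , y ⟫ ≡ ∑[ b ] y
⟪indicator⟫ b y = ∑-cong pointwise
  where
  pointwise : ∀ i → indicator (b i) ℚ.* y i ≡ (if b i then y i else 0ℚ)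
  pointwise i with b i
  ... | true  = ℚₚ.*-identityˡ (y i)
  ... | false = ℚₚ.*-zeroˡ (y i)

∑-point : ∀ {n} (i : Fin n) (y : Fin n → ℚ) → ∑[ (λ j → does (i Finₚ.≟ j)) ] y ≡ y i
∑-point {suc n} zero    y = ≡.trans (cong (y zero ℚ.+_) (∑-zero n)) (ℚₚ.+-identityʳ _)
∑-point {suc n} (suc i) y = ≡.trans (ℚₚ.+-identityˡ _) (∑-point i (y ∘ suc))

-- Fractional covers as a linear program

module FractionalCover {n : ℕ} (G : Graph n) (layer : Fin n → ℕ) (desc : Fin n → Fin n → Bool) (S : Subset n) where
  open Layered G layer using (isCenter)
  open Layered.WithTable G layer desc using (FracCover; IsFcov)

  sign-constraint : Fin n → (Fin n → ℚ) × ℚ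
  sign-constraint i = (λ j → indicator (does (i Finₚ.≟ j))) , 0ℚ

  -- Outside `S` the right-hand side is 0 and the constraint follows from the signs, which allows
  -- one row for every vertex.
  cover-constraint : Fin n → (Fin n → ℚ) × ℚ
  cover-constraint v = (λ c → indicator (isCenter c ∧ desc c v)) , indicator (memb S v)

  open LinearProgram (List.tabulate sign-constraint ++ List.tabulate cover-constraint) (indicator ∘ isCenter)

  feasible⁺ : ∀ y → FracCover S y → Feasible y
  feasible⁺ y (0≤y , covered) = Allₚ.++⁺
    (Allₚ.tabulate⁺ (λ i → subst (0ℚ ℚ.≤_) (≡.sym (≡.trans (⟪indicator⟫ _ y) (∑-point i y))) (0≤y i)))
    (Allₚ.tabulate⁺ (λ v → subst (indicator (memb S v) ℚ.≤_) (≡.sym (⟪indicator⟫ _ y)) (cover v)))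
    where
    cover : ∀ v → indicator (memb S v) ℚ.≤ ∑[ (λ c → isCenter c ∧ desc c v) ] y
    cover v with memb S v in eq
    ... | true  = covered v (Vecₚ.lookup⇒[]= v S eq)
    ... | false = ∑[]-nonneg _ 0≤y

  feasible⁻ : ∀ y → Feasible y → FracCover S y
  feasible⁻ y feas =
    (λ i → subst (0ℚ ℚ.≤_) (≡.trans (⟪indicator⟫ _ y) (∑-point i y))
             (Allₚ.tabulate⁻ (Allₚ.++⁻ˡ (List.tabulate sign-constraint) feas) i)) ,
    (λ v v∈S → subst₂ ℚ._≤_ (cong indicator (Vecₚ.[]=⇒lookup v∈S)) (⟪indicator⟫ _ y)
             (Allₚ.tabulate⁻ (Allₚ.++⁻ʳ (List.tabulate sign-constraint) feas) v))

  fcov-attained : ∀ y₀ → FracCover S y₀ → ∃[ c ] (IsFcov S c × c ℚ.≤ ∑[ isCenter ] y₀)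
  fcov-attained y₀ cover₀ =
    let y , feas , least = attained
          (λ y feas → subst (0ℚ ℚ.≤_) (≡.sym (⟪indicator⟫ isCenter y)) (∑[]-nonneg isCenter (proj₁ (feasible⁻ y feas))))
          y₀ (feasible⁺ y₀ cover₀)
        least′ : ∀ y′ → FracCover S y′ → ∑[ isCenter ] y ℚ.≤ ∑[ isCenter ] y′
        least′ y′ cover = subst₂ ℚ._≤_ (⟪indicator⟫ isCenter y) (⟪indicator⟫ isCenter y′) (least y′ (feasible⁺ y′ cover))
    in ∑[ isCenter ] y , ((y , feasible⁻ y feas , refl) , least′) , least′ y₀ cover₀

-- Rounding the linear program

-- Normalisation goes through a gcd, which does not compute for a variable `m`; this form exposes
-- numerator and denominator.
ℕtoℚ-mkℚ : ∀ m → ℕtoℚ m ≡ mkℚ (ℤ.+ m) 0 (Coprimality.sym (Coprimality.1-coprimeTo m))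
ℕtoℚ-mkℚ m = ℚₚ.normalize-coprime (Coprimality.sym (Coprimality.1-coprimeTo m))

ℕtoℚ-+ : ∀ a b → ℕtoℚ (a + b) ≡ ℕtoℚ a ℚ.+ ℕtoℚ b
ℕtoℚ-+ a b rewrite ℕtoℚ-mkℚ a | ℕtoℚ-mkℚ b =
  cong (λ z → z ℚ./ 1) (≡.sym (cong₂ ℤ._+_ (ℤₚ.*-identityʳ (ℤ.+ a)) (ℤₚ.*-identityʳ (ℤ.+ b))))

ℕtoℚ-* : ∀ a b → ℕtoℚ (a * b) ≡ ℕtoℚ a ℚ.* ℕtoℚ b
ℕtoℚ-* a b rewrite ℕtoℚ-mkℚ a | ℕtoℚ-mkℚ b = cong (λ z → z ℚ./ 1) (ℤₚ.pos-* a b)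

ℕtoℚ-mono-≤ : ∀ {a b} → a ≤ b → ℕtoℚ a ℚ.≤ ℕtoℚ b
ℕtoℚ-mono-≤ {a} {b} a≤b rewrite ℕtoℚ-mkℚ a | ℕtoℚ-mkℚ b =
  ℚ.*≤* (ℤₚ.*-monoʳ-≤-nonNeg (ℤ.+ 1) (ℤ.+≤+ a≤b))

ℕtoℚ-cancel-≤ : ∀ {a b} → ℕtoℚ a ℚ.≤ ℕtoℚ b → a ≤ b
ℕtoℚ-cancel-≤ {a} {b} a≤b rewrite ℕtoℚ-mkℚ a | ℕtoℚ-mkℚ b with a≤b
... | ℚ.*≤* le = ℤₚ.drop‿+≤+ (ℤₚ.*-cancelʳ-≤-pos (ℤ.+ a) (ℤ.+ b) (ℤ.+ 1) le)

ℕtoℚ-nonNeg : ∀ a → ℚ.NonNegative (ℕtoℚ a)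
ℕtoℚ-nonNeg a = ℚₚ.normalize-nonNeg a 1

ℕtoℚ-pos : ∀ {a} → 1 ≤ a → ℚ.Positive (ℕtoℚ a)
ℕtoℚ-pos {a} 1≤a = ℚₚ.normalize-pos a 1 {{_}} {{>-nonZero 1≤a}}

ℕtoℚ-sum : ∀ {n} (f : Fin n → ℕ) → ℕtoℚ (sum f) ≡ ∑ (ℕtoℚ ∘ f)
ℕtoℚ-sum {zero}  f = refl
ℕtoℚ-sum {suc n} f = ≡.trans (ℕtoℚ-+ (f zero) (sum (f ∘ suc))) (cong (ℕtoℚ (f zero) ℚ.+_) (ℕtoℚ-sum (f ∘ suc)))

ℕtoℚ-wt : ∀ {n} (b : Fin n → Bool) (f : Fin n → ℕ) → ℕtoℚ (wt (T? ∘ b) f) ≡ ∑[ b ] (ℕtoℚ ∘ f)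
ℕtoℚ-wt {n} b f = ≡.trans (ℕtoℚ-sum {n} _) (∑-cong pointwise)
  where
  pointwise : ∀ i → ℕtoℚ (if b i then f i else 0) ≡ (if b i then ℕtoℚ (f i) else 0ℚ)
  pointwise i with b i
  ... | true  = refl
  ... | false = refl

ℕtoℚ-size : ∀ {n} (X : Subset n) → ℕtoℚ (size X) ≡ ∑[ memb X ] (λ _ → 1ℚ)
ℕtoℚ-size []          = refl
ℕtoℚ-size (true ∷ X)  = ≡.trans (ℕtoℚ-+ 1 (size X)) (cong (1ℚ ℚ.+_) (ℕtoℚ-size X))
ℕtoℚ-size (false ∷ X) = ≡.trans (ℕtoℚ-size X) (≡.sym (ℚₚ.+-identityˡ _))

fromℚᵘ-mono-≤ : ∀ {p q} → p ℚᵘ.≤ q → ℚ.fromℚᵘ p ℚ.≤ ℚ.fromℚᵘ q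
fromℚᵘ-mono-≤ {p} {q} p≤q = ℚₚ.toℚᵘ-cancel-≤
  (ℚᵘₚ.≤-respˡ-≃ (ℚᵘₚ.≃-sym (ℚₚ.toℚᵘ-fromℚᵘ p)) (ℚᵘₚ.≤-respʳ-≃ (ℚᵘₚ.≃-sym (ℚₚ.toℚᵘ-fromℚᵘ q)) p≤q))

ℕtoℚ≤fraction : ∀ A p d → A * suc d ≤ p → ℕtoℚ A ℚ.≤ ℤ.+ p ℚ./ suc d
ℕtoℚ≤fraction A p d le = fromℚᵘ-mono-≤ {ℚᵘ.mkℚᵘ (ℤ.+ A) 0} {ℚᵘ.mkℚᵘ (ℤ.+ p) d}
  (ℚᵘ.*≤* (subst₂ ℤ._≤_ (ℤₚ.pos-* A (suc d)) (≡.sym (ℤₚ.*-identityʳ (ℤ.+ p))) (ℤ.+≤+ le)))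

-- The floor plus one, also when `q` is an integer, so the result is positive even at 0.
ceiling : ∀ q → 0ℚ ℚ.≤ q → ∃[ m ] (1 ≤ m × q ℚ.≤ ℕtoℚ m × ℕtoℚ m ℚ.≤ q ℚ.+ 1ℚ)
ceiling (mkℚ ℤ.-[1+ a ] d c) (ℚ.*≤* ())
ceiling q@(mkℚ (ℤ.+ a) d c) 0≤q = suc (a / suc d) , s≤s z≤n , upper , lower
  where
  open ≤-Reasoning
  upper : q ℚ.≤ ℕtoℚ (suc (a / suc d))
  upper rewrite ℕtoℚ-mkℚ (suc (a / suc d)) = ℚ.*≤* (subst₂ ℤ._≤_ (≡.sym (ℤₚ.*-identityʳ (ℤ.+ a))) (ℤₚ.pos-* (suc (a / suc d)) (suc d))
    (ℤ.+≤+ (begin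
      a                                      ≡⟨ DivMod.m≡m%n+[m/n]*n a (suc d) ⟩
      a DivMod.% suc d + a / suc d * suc d   ≤⟨ ℕₚ.+-monoˡ-≤ _ (ℕₚ.<⇒≤ (DivMod.m%n<n a (suc d))) ⟩
      suc d + a / suc d * suc d              ∎)))
  floor : ℕtoℚ (a / suc d) ℚ.≤ q
  floor rewrite ℕtoℚ-mkℚ (a / suc d) = ℚ.*≤* (subst₂ ℤ._≤_ (ℤₚ.pos-* (a / suc d) (suc d)) (≡.sym (ℤₚ.*-identityʳ (ℤ.+ a)))
    (ℤ.+≤+ (DivMod.m/n*n≤m a (suc d))))
  lower : ℕtoℚ (suc (a / suc d)) ℚ.≤ q ℚ.+ 1ℚ
  lower = subst (ℚ._≤ q ℚ.+ 1ℚ) (≡.trans (ℚₚ.+-comm (ℕtoℚ (a / suc d)) 1ℚ) (≡.sym (ℕtoℚ-+ 1 (a / suc d))))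
            (ℚₚ.+-monoˡ-≤ 1ℚ floor)

ℕtoℚ-^ : ∀ a k → ℕtoℚ a ^ℚ k ≡ ℕtoℚ (a ^ k)
ℕtoℚ-^ a zero    = refl
ℕtoℚ-^ a (suc k) = ≡.trans (cong (ℕtoℚ a ℚ.*_) (ℕtoℚ-^ a k)) (≡.sym (ℕtoℚ-* a (a ^ k)))

*-mono-≤ : ∀ {p q r s} → 0ℚ ℚ.≤ p → 0ℚ ℚ.≤ s → p ℚ.≤ q → r ℚ.≤ s → p ℚ.* r ℚ.≤ q ℚ.* s
*-mono-≤ {p} {q} {r} {s} 0≤p 0≤s p≤q r≤s = ℚₚ.≤-trans
  (ℚₚ.*-monoˡ-≤-nonNeg p {{ℚ.nonNegative 0≤p}} r≤s) (ℚₚ.*-monoʳ-≤-nonNeg s {{ℚ.nonNegative 0≤s}} p≤q)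

0≤ℕtoℚ : ∀ a → 0ℚ ℚ.≤ ℕtoℚ a
0≤ℕtoℚ a = ℚₚ.nonNegative⁻¹ (ℕtoℚ a) {{ℕtoℚ-nonNeg a}}

0≤* : ∀ {p q} → 0ℚ ℚ.≤ p → 0ℚ ℚ.≤ q → 0ℚ ℚ.≤ p ℚ.* q
0≤* {p} {q} 0≤p 0≤q = subst (ℚ._≤ p ℚ.* q) (ℚₚ.*-zeroʳ p) (ℚₚ.*-monoˡ-≤-nonNeg p {{ℚ.nonNegative 0≤p}} 0≤q)

ℕtoℚ-^-≤ : ∀ a b k → ℕtoℚ a ℚ.≤ b → ℕtoℚ (a ^ k) ℚ.≤ b ^ℚ k
ℕtoℚ-^-≤ a b k a≤b = subst (ℚ._≤ b ^ℚ k) (ℕtoℚ-^ a k) (go k)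
  where
  0≤^ : ∀ k → 0ℚ ℚ.≤ b ^ℚ k
  0≤^ zero    = 0≤ℕtoℚ 1
  0≤^ (suc k) = 0≤* (ℚₚ.≤-trans (0≤ℕtoℚ a) a≤b) (0≤^ k)
  go : ∀ k → ℕtoℚ a ^ℚ k ℚ.≤ b ^ℚ k
  go zero    = ℚₚ.≤-refl
  go (suc k) = *-mono-≤ (0≤ℕtoℚ a) (0≤^ k) a≤b (go k)

-- Were `p` below `A * suc d`, then 2^p would be at most (2^A)^(d+1), hence at most b^(d+1).
log2-lower : ∀ A b p d → ℕtoℚ (2 ^ A) ℚ.≤ b → Log2Above b p d → ℕtoℚ A ℚ.≤ ℤ.+ p ℚ./ suc d
log2-lower A b p d 2^A≤b above = ℕtoℚ≤fraction A p d (ℕₚ.≮⇒≥ (λ p<A → ℚₚ.<-irrefl refl (ℚₚ.<-≤-trans above (begin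
  ℕtoℚ 2 ^ℚ p                ≡⟨ ℕtoℚ-^ 2 p ⟩
  ℕtoℚ (2 ^ p)               ≤⟨ ℕtoℚ-mono-≤ (ℕₚ.^-monoʳ-≤ 2 (ℕₚ.<⇒≤ p<A)) ⟩
  ℕtoℚ (2 ^ (A * suc d))     ≡⟨ cong ℕtoℚ (ℕₚ.^-*-assoc 2 A (suc d)) ⟨
  ℕtoℚ ((2 ^ A) ^ suc d)     ≤⟨ ℕtoℚ-^-≤ (2 ^ A) b (suc d) 2^A≤b ⟩
  b ^ℚ suc d                 ∎))))
  where open ℚₚ.≤-Reasoning

floor-log2 : ∀ k → 1 ≤ k → ∃[ L ] (2 ^ L ≤ k × k < 2 ^ suc L)
floor-log2 (suc zero)    _ = 0 , s≤s z≤n , s≤s (s≤s z≤n)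
floor-log2 (suc (suc k)) _ with floor-log2 (suc k) (s≤s z≤n)
... | L , lower , upper with suc (suc k) <? 2 ^ suc L
...   | yes lt = L , ℕₚ.m≤n⇒m≤1+n lower , lt
...   | no ¬lt = suc L , ℕₚ.≮⇒≥ ¬lt , (begin-strict
    suc (suc k)          ≤⟨ upper ⟩
    2 ^ suc L            <⟨ ℕₚ.m<m*n (2 ^ suc L) 2 {{ℕₚ.m^n≢0 2 (suc L)}} (s≤s (s≤s z≤n)) ⟩
    2 ^ suc L * 2        ≡⟨ ℕₚ.*-comm (2 ^ suc L) 2 ⟩
    2 ^ suc (suc L)      ∎)
  where open ≤-Reasoning

-- Balance from spreading, and the arithmetic of the constants

-- On `X` the value `20 d v` is at most 20, and at most 1 on `Y`, while spreading makes the sum at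
-- least `2 |X|`. Hence `19 |Y| ≤ 18 |X|`, and 18/19 < 95/100.
balance : ∀ {n} (X Y : Subset n) (d : Fin n → ℚ) → Y ⊆ X →
          ℕtoℚ (size X) ℚ.* (ℤ.+ 1 ℚ./ 10) ℚ.≤ ∑[ memb X ] d →
          (∀ v → v ∈ X → d v ℚ.≤ 1ℚ) → (∀ v → v ∈ Y → ℕtoℚ 20 ℚ.* d v ℚ.≤ 1ℚ) →
          100 * size Y ≤ 95 * size X
balance {n} X Y d Y⊆X spread d≤1 close = ℕₚ.*-cancelˡ-≤ 19 (begin
  19 * (100 * size Y)   ≡⟨ lemma₁ (size Y) ⟩
  100 * (19 * size Y)   ≤⟨ ℕₚ.*-monoʳ-≤ 100 (ℕₚ.+-cancelˡ-≤ (2 * size X) _ _ key) ⟩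
  100 * (18 * size X)   ≤⟨ ℕₚ.m≤m+n _ (5 * size X) ⟩
  100 * (18 * size X) + 5 * size X ≡⟨ lemma₂ (size X) ⟩
  19 * (95 * size X)    ∎)
  where
  open ≤-Reasoning
  lemma₁ : ∀ y → 19 * (100 * y) ≡ 100 * (19 * y)
  lemma₁ = solve-∀
  lemma₂ : ∀ x → 100 * (18 * x) + 5 * x ≡ 19 * (95 * x)
  lemma₂ = solve-∀
  lemma₃ : ∀ x → 20 * x ≡ 2 * x + 18 * x
  lemma₃ = solve-∀
  pointwise : ∀ v → ℕtoℚ 20 ℚ.* (if memb X v then d v else 0ℚ) ℚ.+ ℕtoℚ 19 ℚ.* (if memb Y v then 1ℚ else 0ℚ)
                    ℚ.≤ ℕtoℚ 20 ℚ.* (if memb X v then 1ℚ else 0ℚ)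
  pointwise v with memb X v in eqX | memb Y v in eqY
  ... | true  | true  = ℚₚ.+-monoˡ-≤ (ℕtoℚ 19) (close v (Vecₚ.lookup⇒[]= v Y eqY))
  ... | true  | false = subst (ℚ._≤ ℕtoℚ 20) (≡.sym (ℚₚ.+-identityʳ (ℕtoℚ 20 ℚ.* d v)))
                          (ℚₚ.*-monoˡ-≤-nonNeg (ℕtoℚ 20) (d≤1 v (Vecₚ.lookup⇒[]= v X eqX)))
  ... | false | true  = contradiction (≡.trans (≡.sym (Vecₚ.[]=⇒lookup (Y⊆X (Vecₚ.lookup⇒[]= v Y eqY)))) eqX) λ ()
  ... | false | false = ℚₚ.≤-refl
  key : 2 * size X + 19 * size Y ≤ 2 * size X + 18 * size X
  key = ℕₚ.≤-trans (ℕtoℚ-cancel-≤ (ℚR.begin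
    ℕtoℚ (2 * size X + 19 * size Y)
      ℚR.≡⟨ ≡.trans (ℕtoℚ-+ (2 * size X) (19 * size Y)) (cong₂ ℚ._+_ twice (ℕtoℚ-* 19 (size Y))) ⟩
    ℕtoℚ 20 ℚ.* (ℕtoℚ (size X) ℚ.* (ℤ.+ 1 ℚ./ 10)) ℚ.+ ℕtoℚ 19 ℚ.* ℕtoℚ (size Y)
      ℚR.≤⟨ ℚₚ.+-monoˡ-≤ _ (ℚₚ.*-monoˡ-≤-nonNeg (ℕtoℚ 20) spread) ⟩
    ℕtoℚ 20 ℚ.* ∑[ memb X ] d ℚ.+ ℕtoℚ 19 ℚ.* ℕtoℚ (size Y)
      ℚR.≡⟨ cong₂ ℚ._+_ (*-distribˡ-∑ {n} (ℕtoℚ 20) _) (≡.trans (cong (ℕtoℚ 19 ℚ.*_) (ℕtoℚ-size Y)) (*-distribˡ-∑ {n} (ℕtoℚ 19) _)) ⟩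
    ∑ (λ v → ℕtoℚ 20 ℚ.* (if memb X v then d v else 0ℚ)) ℚ.+ ∑ (λ v → ℕtoℚ 19 ℚ.* (if memb Y v then 1ℚ else 0ℚ))
      ℚR.≡⟨ ∑-distrib-+ℚ {n} _ _ ⟨
    ∑ (λ v → ℕtoℚ 20 ℚ.* (if memb X v then d v else 0ℚ) ℚ.+ ℕtoℚ 19 ℚ.* (if memb Y v then 1ℚ else 0ℚ))
      ℚR.≤⟨ ∑-mono pointwise ⟩
    ∑ (λ v → ℕtoℚ 20 ℚ.* (if memb X v then 1ℚ else 0ℚ))
      ℚR.≡⟨ ≡.trans (cong (ℕtoℚ 20 ℚ.*_) (ℕtoℚ-size X)) (*-distribˡ-∑ {n} (ℕtoℚ 20) _) ⟨
    ℕtoℚ 20 ℚ.* ℕtoℚ (size X)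
      ℚR.≡⟨ ℕtoℚ-* 20 (size X) ⟨
    ℕtoℚ (20 * size X) ℚR.∎)) (ℕₚ.≤-reflexive (lemma₃ (size X)))
    where
    module ℚR = ℚₚ.≤-Reasoning
    twice : ℕtoℚ (2 * size X) ≡ ℕtoℚ 20 ℚ.* (ℕtoℚ (size X) ℚ.* (ℤ.+ 1 ℚ./ 10))
    twice = ≡.trans (ℕtoℚ-* 2 (size X))
      (solve 1 (λ x → con (ℕtoℚ 2) :* x := con (ℕtoℚ 20) :* (x :* con (ℤ.+ 1 ℚ./ 10))) refl (ℕtoℚ (size X)))
      where open +-*-Solver

anyFin⁻ : ∀ {n} (f : Fin n → Bool) → T (anyFin f) → ∃[ i ] T (f i)
anyFin⁻ {suc n} f t with Equivalence.to (Boolₚ.T-∨ {f zero}) t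
... | inj₁ t₀ = zero , t₀
... | inj₂ t′ = let i , tᵢ = anyFin⁻ (f ∘ suc) t′ in suc i , tᵢ

∑-ones : ∀ n → ∑ {n} (λ _ → 1ℚ) ≡ ℕtoℚ n
∑-ones zero    = refl
∑-ones (suc n) = ≡.trans (cong (1ℚ ℚ.+_) (∑-ones n)) (≡.sym (ℕtoℚ-+ 1 n))

0≤fraction : ∀ p d → 0ℚ ℚ.≤ ℤ.+ p ℚ./ suc d
0≤fraction p d = ℚₚ.nonNegative⁻¹ _ {{ℚₚ.normalize-nonNeg p (suc d)}}

nonempty-index : ∀ {n} (b : Fin n → Bool) (x : Fin n → ℚ) → ¬ (ℕtoℚ 20 ℚ.* ∑[ b ] x ℚ.≤ 1ℚ) → 1 ≤ n
nonempty-index {zero}  b x ¬small = contradiction (ℚ.*≤* (ℤ.+≤+ z≤n)) ¬small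
nonempty-index {suc n} b x ¬small = s≤s z≤n

if-lower : ∀ b {q a} → T b → q ℚ.≤ ℕtoℚ a → q ℚ.≤ ℕtoℚ (if b then a else 0)
if-lower true _ q≤a = q≤a

if-upper : ∀ b {a} q x → ℕtoℚ a ℚ.≤ q ℚ.* x ℚ.+ 1ℚ → ℕtoℚ (if b then a else 0) ℚ.≤ q ℚ.* (if b then x else 0ℚ) ℚ.+ 1ℚ
if-upper true  q x a≤ = a≤
if-upper false q x a≤ = ℚₚ.≤-trans (0≤ℕtoℚ 1) (ℚₚ.≤-reflexive (≡.sym (≡.trans (cong (ℚ._+ 1ℚ) (ℚₚ.*-zeroʳ q)) (ℚₚ.+-identityˡ 1ℚ))))

-- This determines `J`. Since `Q = 100 * (J * e)` and `n < 2 * e`, the left side is at most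
-- `101 * φ * (J * e)`. With 101 ≤ 2^7 and φ < 2^(L+1), an exponent of `L + 8` is enough, and
-- `5 * L` reaches it once `L ≥ 2`.
doubling-suffices : ∀ L φ n e {J R Q} → J ≡ 5 * L → R ≡ 5 * (J * e) → Q ≡ 20 * R →
                    2 ≤ L → 1 ≤ φ → φ + 3 < 2 ^ suc L → n < 2 * e → Q * φ + n < 2 ^ J * (J * e)
doubling-suffices L φ n e refl refl refl 2≤L 1≤φ φ<2^L n<2e = begin-strict
  20 * (5 * (5 * L * e)) * φ + n             <⟨ ℕₚ.+-monoʳ-< (20 * (5 * (5 * L * e)) * φ) n<2e ⟩
  20 * (5 * (5 * L * e)) * φ + 2 * e         ≤⟨ ℕₚ.+-monoʳ-≤ (20 * (5 * (5 * L * e)) * φ)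
                                                 (ℕₚ.≤-trans (ℕₚ.*-monoˡ-≤ e (ℕₚ.≤-trans 2≤L (ℕₚ.m≤n*m L 5)))
                                                             (ℕₚ.m≤m*n (5 * L * e) φ {{>-nonZero 1≤φ}})) ⟩
  20 * (5 * (5 * L * e)) * φ + 5 * L * e * φ ≡⟨ lemma₁ (5 * L * e) φ ⟩
  101 * φ * (5 * L * e)                      ≤⟨ ℕₚ.*-monoˡ-≤ (5 * L * e) 101φ≤2^5L ⟩
  2 ^ (5 * L) * (5 * L * e)                  ∎
  where
  open ≤-Reasoning
  lemma₁ : ∀ a φ → 20 * (5 * a) * φ + a * φ ≡ 101 * φ * a
  lemma₁ = solve-∀
  lemma₂ : ∀ L → 7 + suc L ≡ 4 * 2 + L
  lemma₂ = solve-∀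
  lemma₃ : ∀ L → 4 * L + L ≡ 5 * L
  lemma₃ = solve-∀
  7+sL≤5L : 7 + suc L ≤ 5 * L
  7+sL≤5L = begin
    7 + suc L     ≡⟨ lemma₂ L ⟩
    4 * 2 + L     ≤⟨ ℕₚ.+-monoˡ-≤ L (ℕₚ.*-monoʳ-≤ 4 2≤L) ⟩
    4 * L + L     ≡⟨ lemma₃ L ⟩
    5 * L         ∎
  101φ≤2^5L : 101 * φ ≤ 2 ^ (5 * L)
  101φ≤2^5L = begin
    101 * φ             ≤⟨ ℕₚ.*-mono-≤ (ℕₚ.m≤m+n 101 27) (ℕₚ.≤-trans (ℕₚ.m≤m+n φ 3) (ℕₚ.<⇒≤ φ<2^L)) ⟩
    2 ^ 7 * 2 ^ suc L   ≡⟨ ℕₚ.^-distribˡ-+-* 2 7 (suc L) ⟨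
    2 ^ (7 + suc L)     ≤⟨ ℕₚ.^-monoʳ-≤ 2 7+sL≤5L ⟩
    2 ^ (5 * L)         ∎

-- The origin of 5000: `2 * Q` is `1000 * L * e`, and `4 * E + 1 ≤ 5 * suc E`, with slack `E + 4`.
constants-suffice : ∀ E L e {J R Q K} → J ≡ 5 * L → R ≡ 5 * (J * e) → Q ≡ 20 * R → 5000 ≤ K →
                    (4 * E + 1) * (2 * Q) ≤ e * (K * suc E * L)
constants-suffice E L e {K = K} refl refl refl 5000≤K = begin
  (4 * E + 1) * (2 * (20 * (5 * (5 * L * e))))    ≤⟨ ℕₚ.m≤m+n _ ((E + 4) * (1000 * (L * e))) ⟩
  (4 * E + 1) * (2 * (20 * (5 * (5 * L * e)))) + (E + 4) * (1000 * (L * e))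
                                                  ≡⟨ lemma E L e ⟩
  e * (5000 * suc E * L)                          ≤⟨ ℕₚ.*-monoʳ-≤ e (ℕₚ.*-monoˡ-≤ L (ℕₚ.*-monoˡ-≤ (suc E) 5000≤K)) ⟩
  e * (K * suc E * L)                             ∎
  where
  open ≤-Reasoning
  lemma : ∀ E L e → (4 * E + 1) * (2 * (20 * (5 * (5 * L * e)))) + (E + 4) * (1000 * (L * e)) ≡ e * (5000 * suc E * L)
  lemma = solve-∀

-- From a fractional solution to a separator and its cover

module LPRounding {n : ℕ} (G : Graph n) (K : ℕ) (5000≤K : 5000 ≤ K) (layer : Fin n → ℕ) (desc : Fin n → Fin n → Bool)
  (desc⇔ : ∀ c v → T (desc c v) ⇔ Layered.Desc G layer c v) (X : Subset n)
  (x : Fin n → ℚ) (d : Fin n → Fin n → ℚ) (feasible : Layered.WithTable.LPFeasible G layer desc X x d) where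

  open Layered G layer using (isCenter; ConnAvoid; here; there; BalancedSep)
  open Layered.WithTable G layer desc
  open Walks G
  open InducedPaths G layer desc using (inducedPath)

  f : ℚ
  f = ∑[ isCenter ] x

  0≤x : ∀ c → 0ℚ ℚ.≤ x c
  0≤x = proj₁ feasible

  d≤path : ∀ u v → u ∈ X → v ∈ X → (P : InducedPath u v) → d u v ℚ.≤ ∑[ (λ c → isCenter c ∧ meets c P) ] x
  d≤path = proj₁ (proj₂ (proj₂ (proj₂ feasible)))

  0≤f : 0ℚ ℚ.≤ f
  0≤f = ∑[]-nonneg isCenter 0≤x

  Bounded : ℚ → Set
  Bounded c = ∀ p q p′ q′ → Log2Above (ℕtoℚ (2 * n)) p q → Log2Above (f ℚ.+ ℕtoℚ 4) p′ q′ →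
    c ℚ.≤ ℕtoℚ K ℚ.* (ℤ.+ p ℚ./ suc q) ℚ.* (ℤ.+ p′ ℚ./ suc q′) ℚ.* f

  Result : Set
  Result = Σ (Subset n) λ S → BalancedSep X S × DownwardClosed S × Σ ℚ λ c → IsFcov S c × Bounded c

  conn⇒walk : ∀ {S a y} → ConnAvoid S a y → Walk (_∉ S) a y
  conn⇒walk (here a∉S)      = here a∉S
  conn⇒walk (there a∉S e w) = there a∉S e (conn⇒walk w)

  Clustered : Subset n → Set
  Clustered S = ∀ a → (∀ y → y ∈ X → ¬ Walk (_∉ S) a y) ⊎
    ∃[ u ] (u ∈ X × (∀ y → y ∈ X → Walk (_∉ S) a y → ℕtoℚ 20 ℚ.* d u y ℚ.≤ 1ℚ))

  clustered⇒balanced : ∀ S → Clustered S → BalancedSep X S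
  clustered⇒balanced S clustered a a∉S Y Y⊆X conn with clustered a
  ... | inj₂ (u , u∈X , close) = balance X Y (d u) Y⊆X (proj₁ (proj₂ (proj₂ feasible)) u u∈X)
    (λ v → proj₂ (proj₂ (proj₂ (proj₂ feasible))) u v u∈X) (λ v v∈Y → close v (Y⊆X v∈Y) (conn⇒walk (conn v v∈Y)))
  ... | inj₁ none = subst (λ Y → 100 * size Y ≤ 95 * size X)
    (≡.sym (Subₚ.Empty-unique (λ (y , y∈Y) → none y (Y⊆X y∈Y) (conn⇒walk (conn y y∈Y)))))
    (subst (λ s → 100 * s ≤ 95 * size X) (≡.sym (Subₚ.∣⊥∣≡0 n)) z≤n)

  bounded : ∀ S y → FracCover S y → Bounded (∑[ isCenter ] y) → Σ ℚ λ c → IsFcov S c × Bounded c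
  bounded S y cover bound =
    let c , isFcov , c≤ = FractionalCover.fcov-attained G layer desc S y cover
    in c , isFcov , λ p q p′ q′ l l′ → ℚₚ.≤-trans c≤ (bound p q p′ q′ l l′)

  -- Any two connected vertices of `X` have `d` at most the total `f`, so at most 1/20, and removing
  -- nothing is already balanced.
  small-value : ℕtoℚ 20 ℚ.* f ℚ.≤ 1ℚ → Result
  small-value 20f≤1 = ∅ , clustered⇒balanced ∅ clustered , (λ u v u∈∅ → contradiction u∈∅ Subₚ.∉⊥) ,
    bounded ∅ (λ _ → 0ℚ) ((λ _ → ℚₚ.≤-refl) , λ v v∈∅ → contradiction v∈∅ Subₚ.∉⊥)
      (λ p q p′ q′ _ _ → ℚₚ.≤-trans (ℚₚ.≤-reflexive no-cost)
        (0≤* (0≤* (0≤* (0≤ℕtoℚ K) (0≤fraction p q)) (0≤fraction p′ q′)) 0≤f))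
    where
    no-cost : ∑[ isCenter ] (λ _ → 0ℚ) ≡ 0ℚ
    no-cost = ≡.trans (∑-cong (λ c → Boolₚ.if-eta (isCenter c))) (∑-zero n)
    near : ∀ {u y} → u ∈ X → y ∈ X → Walk (_∉ ∅) u y → ℕtoℚ 20 ℚ.* d u y ℚ.≤ 1ℚ
    near {u} {y} u∈X y∈X W = let P , _ = inducedPath W in
      ℚₚ.≤-trans (ℚₚ.*-monoˡ-≤-nonNeg (ℕtoℚ 20) (ℚₚ.≤-trans (d≤path u y u∈X y∈X P)
        (∑[]-mono (λ c → isCenter c ∧ meets c P) isCenter 0≤x (λ c t → proj₁ (Equivalence.to Boolₚ.T-∧ t) , ℚₚ.≤-refl)))) 20f≤1
    clustered : Clustered ∅
    clustered a with Finₚ.any? (λ u → u Subₚ.∈? X ×-dec walk? (λ v → ¬? (v Subₚ.∈? ∅)) a u)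
    ... | yes (u , u∈X , W) = inj₂ (u , u∈X , λ y y∈X W′ → near u∈X y∈X (walk-reverse W ++ʷ W′))
    ... | no none           = inj₁ (λ y y∈X W → none (y , y∈X , W))

  -- The weights are Q x rounded up, at the scale where the radius R corresponds to
  -- distance 1/20; the rounding adds at most n ≤ R ≤ Q f because f ≥ 1/20.
  module Large (20f≰1 : ¬ (ℕtoℚ 20 ℚ.* f ℚ.≤ 1ℚ))
    (φ : ℕ) (1≤φ : 1 ≤ φ) (f≤φ : f ℚ.≤ ℕtoℚ φ) (φ≤f+1 : ℕtoℚ φ ℚ.≤ f ℚ.+ 1ℚ)
    (L : ℕ) (2^L≤ : 2 ^ L ≤ φ + 3) (<2^L : φ + 3 < 2 ^ suc L)
    (E : ℕ) (2^E≤n : 2 ^ E ≤ n) (n<2^E : n < 2 ^ suc E)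
    (J R Q : ℕ) (J≡ : J ≡ 5 * L) (R≡ : R ≡ 5 * (J * 2 ^ E)) (Q≡ : Q ≡ 20 * R)
    (m₀ : Fin n → ℕ) (m₀-lower : ∀ c → ℕtoℚ Q ℚ.* x c ℚ.≤ ℕtoℚ (m₀ c))
    (m₀-upper : ∀ c → ℕtoℚ (m₀ c) ℚ.≤ ℕtoℚ Q ℚ.* x c ℚ.+ 1ℚ) where

    m : Fin n → ℕ
    m c = if isCenter c then m₀ c else 0

    m-lower : ∀ c → T (isCenter c) → ℕtoℚ Q ℚ.* x c ℚ.≤ ℕtoℚ (m c)
    m-lower c center = if-lower (isCenter c) center (m₀-lower c)

    m-upper : ∀ c → ℕtoℚ (m c) ℚ.≤ ℕtoℚ Q ℚ.* (if isCenter c then x c else 0ℚ) ℚ.+ 1ℚ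
    m-upper c = if-upper (isCenter c) (ℕtoℚ Q) (x c) (m₀-upper c)

    total-upper : ℕtoℚ (sum m) ℚ.≤ ℕtoℚ Q ℚ.* f ℚ.+ ℕtoℚ n
    total-upper = begin
      ℕtoℚ (sum m)                                                         ≡⟨ ℕtoℚ-sum m ⟩
      ∑ (ℕtoℚ ∘ m)                                                         ≤⟨ ∑-mono m-upper ⟩
      ∑ (λ c → ℕtoℚ Q ℚ.* (if isCenter c then x c else 0ℚ) ℚ.+ 1ℚ)         ≡⟨ ∑-distrib-+ℚ {n} _ _ ⟩
      ∑ (λ c → ℕtoℚ Q ℚ.* (if isCenter c then x c else 0ℚ)) ℚ.+ ∑ {n} (λ _ → 1ℚ)
        ≡⟨ cong₂ ℚ._+_ (≡.sym (*-distribˡ-∑ {n} (ℕtoℚ Q) _)) (∑-ones n) ⟩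
      ℕtoℚ Q ℚ.* f ℚ.+ ℕtoℚ n ∎
      where open ℚₚ.≤-Reasoning

    -- The 3 in `φ + 3` serves twice: with `1 ≤ φ` it forces `L ≥ 2`, and with `φ ≤ f + 1` it gives
    -- 2^L ≤ f + 4.
    2≤L : 2 ≤ L
    2≤L = ℕₚ.≮⇒≥ (λ L<2 → ℕₚ.<⇒≱ <2^L (ℕₚ.≤-trans (ℕₚ.^-monoʳ-≤ 2 L<2) (ℕₚ.+-monoˡ-≤ 3 1≤φ)))

    2≤J : 2 ≤ J
    2≤J = ℕₚ.≤-trans 2≤L (ℕₚ.≤-trans (ℕₚ.m≤n*m L 5) (ℕₚ.≤-reflexive (≡.sym J≡)))

    1≤J : 1 ≤ J
    1≤J = ℕₚ.<⇒≤ 2≤J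

    Je≤R : J * 2 ^ E ≤ R
    Je≤R = ℕₚ.≤-trans (ℕₚ.m≤n*m (J * 2 ^ E) 5) (ℕₚ.≤-reflexive (≡.sym R≡))

    20R≡Q : ℕtoℚ 20 ℚ.* ℕtoℚ R ≡ ℕtoℚ Q
    20R≡Q = ≡.trans (≡.sym (ℕtoℚ-* 20 R)) (cong ℕtoℚ (≡.sym Q≡))

    small : sum m < 2 ^ J * (J * 2 ^ E)
    small = ℕₚ.≤-<-trans (ℕtoℚ-cancel-≤ (begin
      ℕtoℚ (sum m)                     ≤⟨ total-upper ⟩
      ℕtoℚ Q ℚ.* f ℚ.+ ℕtoℚ n          ≤⟨ ℚₚ.+-monoˡ-≤ (ℕtoℚ n) (ℚₚ.*-monoˡ-≤-nonNeg (ℕtoℚ Q) {{ℕtoℚ-nonNeg Q}} f≤φ) ⟩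
      ℕtoℚ Q ℚ.* ℕtoℚ φ ℚ.+ ℕtoℚ n     ≡⟨ ≡.trans (ℕtoℚ-+ (Q * φ) n) (cong (ℚ._+ ℕtoℚ n) (ℕtoℚ-* Q φ)) ⟨
      ℕtoℚ (Q * φ + n)                 ∎)) (doubling-suffices L φ n (2 ^ E) J≡ R≡ Q≡ 2≤L 1≤φ <2^L n<2^E)
      where open ℚₚ.≤-Reasoning

    open Carving G layer desc desc⇔ m E J using (Close; module Separator)

    1≤R : 1 ≤ R
    1≤R = ℕₚ.≤-trans (ℕₚ.*-mono-≤ 1≤J (ℕₚ.m^n>0 2 E)) Je≤R

    -- An induced path through vertices of the walk meets only members of `F`, so `Q * d u y` is at
    -- most the weight of `F`, hence at most `R`, and `Q = 20 * R`.
    close⇒d-small : ∀ u y → u ∈ X → y ∈ X → Close u y → ℕtoℚ 20 ℚ.* d u y ℚ.≤ 1ℚ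
    close⇒d-small u y u∈X y∈X (F , wt≤R , W) =
      ℚₚ.*-cancelˡ-≤-pos (ℕtoℚ R) {{ℕtoℚ-pos 1≤R}} (begin
        ℕtoℚ R ℚ.* (ℕtoℚ 20 ℚ.* d u y)
          ≡⟨ solve 3 (λ r t z → r :* (t :* z) := (t :* r) :* z) refl (ℕtoℚ R) (ℕtoℚ 20) (d u y) ⟩
        (ℕtoℚ 20 ℚ.* ℕtoℚ R) ℚ.* d u y     ≡⟨ cong (ℚ._* d u y) 20R≡Q ⟩
        ℕtoℚ Q ℚ.* d u y                   ≤⟨ ℚₚ.*-monoˡ-≤-nonNeg (ℕtoℚ Q) {{ℕtoℚ-nonNeg Q}} (d≤path u y u∈X y∈X P) ⟩
        ℕtoℚ Q ℚ.* ∑[ hit ] x              ≡⟨ *-distribˡ-∑[] hit (ℕtoℚ Q) x ⟩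
        ∑[ hit ] (λ c → ℕtoℚ Q ℚ.* x c)    ≤⟨ ∑-mono (λ c → pointwise c (hit c) (c Subₚ.∈? F) id) ⟩
        ∑ (λ c → ℕtoℚ (if does (c Subₚ.∈? F) then m c else 0))  ≡⟨ ℕtoℚ-sum {n} _ ⟨
        ℕtoℚ (wt (Subₚ._∈? F) m)           ≤⟨ ℕtoℚ-mono-≤ (ℕₚ.≤-trans wt≤R (ℕₚ.≤-reflexive (≡.sym R≡))) ⟩
        ℕtoℚ R                             ≡⟨ ℚₚ.*-identityʳ (ℕtoℚ R) ⟨
        ℕtoℚ R ℚ.* 1ℚ                      ∎)
      where
      open ℚₚ.≤-Reasoning
      open +-*-Solver
      P : InducedPath u y
      P = proj₁ (inducedPath W)
      hit : Fin n → Bool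
      hit c = isCenter c ∧ meets c P
      hit⇒∈ : ∀ c → T (hit c) → c ∈ F
      hit⇒∈ c t = let center , met = Equivalence.to (Boolₚ.T-∧ {isCenter c} {meets c P}) t
                      i , t′       = anyFin⁻ (λ i → desc c (InducedPath.vert P i)) met
                  in proj₂ (inducedPath W) i c
                       (Equivalence.from (Boolₚ.T-∧ {isCenter c} {desc c (InducedPath.vert P i)}) (center , t′))
      pointwise : ∀ c b (c∈? : Dec (c ∈ F)) → (T b → T (hit c)) →
                  (if b then ℕtoℚ Q ℚ.* x c else 0ℚ) ℚ.≤ ℕtoℚ (if does c∈? then m c else 0)
      pointwise c true  (yes _)   h = m-lower c (proj₁ (Equivalence.to (Boolₚ.T-∧ {isCenter c} {meets c P}) (h tt)))
      pointwise c true  (no c∉F)  h = contradiction (hit⇒∈ c (h tt)) c∉F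
      pointwise c false c∈?       h = 0≤ℕtoℚ (if does c∈? then m c else 0)

    total-upper′ : ℕtoℚ (sum m) ℚ.≤ ℕtoℚ (2 * Q) ℚ.* f
    total-upper′ = begin
      ℕtoℚ (sum m)                                   ≤⟨ total-upper ⟩
      ℕtoℚ Q ℚ.* f ℚ.+ ℕtoℚ n                        ≤⟨ ℚₚ.+-monoʳ-≤ (ℕtoℚ Q ℚ.* f) (ℕtoℚ-mono-≤ n≤R) ⟩
      ℕtoℚ Q ℚ.* f ℚ.+ ℕtoℚ R                        ≡⟨ cong (ℕtoℚ Q ℚ.* f ℚ.+_) (ℚₚ.*-identityʳ (ℕtoℚ R)) ⟨
      ℕtoℚ Q ℚ.* f ℚ.+ ℕtoℚ R ℚ.* 1ℚ                 ≤⟨ ℚₚ.+-monoʳ-≤ (ℕtoℚ Q ℚ.* f)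
        (ℚₚ.*-monoˡ-≤-nonNeg (ℕtoℚ R) {{ℕtoℚ-nonNeg R}} (ℚₚ.<⇒≤ (ℚₚ.≰⇒> 20f≰1))) ⟩
      ℕtoℚ Q ℚ.* f ℚ.+ ℕtoℚ R ℚ.* (ℕtoℚ 20 ℚ.* f)    ≡⟨ cong (λ q → q ℚ.* f ℚ.+ ℕtoℚ R ℚ.* (ℕtoℚ 20 ℚ.* f)) 20R≡Q ⟨
      (ℕtoℚ 20 ℚ.* ℕtoℚ R) ℚ.* f ℚ.+ ℕtoℚ R ℚ.* (ℕtoℚ 20 ℚ.* f)
        ≡⟨ solve 3 (λ t r f → (t :* r) :* f :+ r :* (t :* f) := (con (ℕtoℚ 2) :* (t :* r)) :* f) refl (ℕtoℚ 20) (ℕtoℚ R) f ⟩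
      (ℕtoℚ 2 ℚ.* (ℕtoℚ 20 ℚ.* ℕtoℚ R)) ℚ.* f
        ≡⟨ cong (ℚ._* f) (≡.trans (cong (ℕtoℚ 2 ℚ.*_) 20R≡Q) (≡.sym (ℕtoℚ-* 2 Q))) ⟩
      ℕtoℚ (2 * Q) ℚ.* f                             ∎
      where
      open ℚₚ.≤-Reasoning
      open +-*-Solver
      n≤R : n ≤ R
      n≤R = ℕₚ.≤-trans (ℕₚ.<⇒≤ n<2^E) (ℕₚ.≤-trans (ℕₚ.*-monoˡ-≤ (2 ^ E) 2≤J) Je≤R)

    module _ (S : Subset n) (pay : Fin n → ℕ) (covered : ∀ v → v ∈ S → 2 ^ E ≤ wt (λ c → T? (isCenter c ∧ desc c v)) pay)
             (cheap : sum pay ≤ (4 * E + 1) * sum m) where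

      instance
        e-pos : ℚ.Positive (ℕtoℚ (2 ^ E))
        e-pos = ℕtoℚ-pos (ℕₚ.m^n>0 2 E)
        e-nonZero : ℚ.NonZero (ℕtoℚ (2 ^ E))
        e-nonZero = ℚₚ.pos⇒nonZero (ℕtoℚ (2 ^ E))

      1/e : ℚ
      1/e = ℚ.1/ ℕtoℚ (2 ^ E)

      1/e-nonNeg : ℚ.NonNegative 1/e
      1/e-nonNeg = ℚₚ.pos⇒nonNeg 1/e {{ℚₚ.1/pos⇒pos (ℕtoℚ (2 ^ E))}}

      y : Fin n → ℚ
      y c = 1/e ℚ.* ℕtoℚ (pay c)

      y-cover : FracCover S y
      y-cover = (λ c → 0≤* (ℚₚ.nonNegative⁻¹ 1/e {{1/e-nonNeg}}) (0≤ℕtoℚ (pay c))) , λ v v∈S → begin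
        1ℚ                                                        ≡⟨ ℚₚ.*-inverseˡ (ℕtoℚ (2 ^ E)) ⟨
        1/e ℚ.* ℕtoℚ (2 ^ E)
          ≤⟨ ℚₚ.*-monoˡ-≤-nonNeg 1/e {{1/e-nonNeg}} (ℕtoℚ-mono-≤ (covered v v∈S)) ⟩
        1/e ℚ.* ℕtoℚ (wt (λ c → T? (isCenter c ∧ desc c v)) pay)
          ≡⟨ cong (1/e ℚ.*_) (ℕtoℚ-wt (λ c → isCenter c ∧ desc c v) pay) ⟩
        1/e ℚ.* ∑[ (λ c → isCenter c ∧ desc c v) ] (ℕtoℚ ∘ pay)
          ≡⟨ *-distribˡ-∑[] (λ c → isCenter c ∧ desc c v) 1/e (ℕtoℚ ∘ pay) ⟩
        ∑[ (λ c → isCenter c ∧ desc c v) ] y                      ∎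
        where open ℚₚ.≤-Reasoning

      e*y : ℕtoℚ (2 ^ E) ℚ.* ∑[ isCenter ] y ℚ.≤ ℕtoℚ (sum pay)
      e*y = begin
        ℕtoℚ (2 ^ E) ℚ.* ∑[ isCenter ] y
          ≡⟨ cong (ℕtoℚ (2 ^ E) ℚ.*_) (*-distribˡ-∑[] isCenter 1/e (ℕtoℚ ∘ pay)) ⟨
        ℕtoℚ (2 ^ E) ℚ.* (1/e ℚ.* ∑[ isCenter ] (ℕtoℚ ∘ pay))     ≡⟨ ℚₚ.*-assoc (ℕtoℚ (2 ^ E)) 1/e _ ⟨
        (ℕtoℚ (2 ^ E) ℚ.* 1/e) ℚ.* ∑[ isCenter ] (ℕtoℚ ∘ pay)
          ≡⟨ cong (ℚ._* ∑[ isCenter ] (ℕtoℚ ∘ pay)) (ℚₚ.*-inverseʳ (ℕtoℚ (2 ^ E))) ⟩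
        1ℚ ℚ.* ∑[ isCenter ] (ℕtoℚ ∘ pay)                         ≡⟨ ℚₚ.*-identityˡ _ ⟩
        ∑[ isCenter ] (ℕtoℚ ∘ pay)                                ≡⟨ ℕtoℚ-wt isCenter pay ⟨
        ℕtoℚ (wt (T? ∘ isCenter) pay)                             ≤⟨ ℕtoℚ-mono-≤ (wt≤sum (T? ∘ isCenter) pay) ⟩
        ℕtoℚ (sum pay)                                            ∎
        where open ℚₚ.≤-Reasoning

      constants : (4 * E + 1) * (2 * Q) ≤ 2 ^ E * (K * suc E * L)
      constants = constants-suffice E L (2 ^ E) J≡ R≡ Q≡ 5000≤K

      y-bound : ∀ s t → ℕtoℚ (suc E) ℚ.≤ s → ℕtoℚ L ℚ.≤ t → ∑[ isCenter ] y ℚ.≤ ℕtoℚ K ℚ.* s ℚ.* t ℚ.* f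
      y-bound s t E≤s L≤t = ℚₚ.≤-trans (ℚₚ.*-cancelˡ-≤-pos (ℕtoℚ (2 ^ E)) (begin
          ℕtoℚ (2 ^ E) ℚ.* ∑[ isCenter ] y                    ≤⟨ e*y ⟩
          ℕtoℚ (sum pay)                                      ≤⟨ ℕtoℚ-mono-≤ cheap ⟩
          ℕtoℚ ((4 * E + 1) * sum m)                          ≡⟨ ℕtoℚ-* (4 * E + 1) (sum m) ⟩
          ℕtoℚ (4 * E + 1) ℚ.* ℕtoℚ (sum m)
            ≤⟨ ℚₚ.*-monoˡ-≤-nonNeg (ℕtoℚ (4 * E + 1)) {{ℕtoℚ-nonNeg (4 * E + 1)}} total-upper′ ⟩
          ℕtoℚ (4 * E + 1) ℚ.* (ℕtoℚ (2 * Q) ℚ.* f)           ≡⟨ ℚₚ.*-assoc (ℕtoℚ (4 * E + 1)) (ℕtoℚ (2 * Q)) f ⟨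
          (ℕtoℚ (4 * E + 1) ℚ.* ℕtoℚ (2 * Q)) ℚ.* f           ≡⟨ cong (ℚ._* f) (ℕtoℚ-* (4 * E + 1) (2 * Q)) ⟨
          ℕtoℚ ((4 * E + 1) * (2 * Q)) ℚ.* f
            ≤⟨ ℚₚ.*-monoʳ-≤-nonNeg f {{ℚ.nonNegative 0≤f}} (ℕtoℚ-mono-≤ constants) ⟩
          ℕtoℚ (2 ^ E * (K * suc E * L)) ℚ.* f         ≡⟨ cong (ℚ._* f) (ℕtoℚ-* (2 ^ E) (K * suc E * L)) ⟩
          (ℕtoℚ (2 ^ E) ℚ.* ℕtoℚ (K * suc E * L)) ℚ.* f ≡⟨ ℚₚ.*-assoc (ℕtoℚ (2 ^ E)) (ℕtoℚ (K * suc E * L)) f ⟩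
          ℕtoℚ (2 ^ E) ℚ.* (ℕtoℚ (K * suc E * L) ℚ.* f) ∎))
        (begin
          ℕtoℚ (K * suc E * L) ℚ.* f
            ≡⟨ cong (ℚ._* f) (≡.trans (ℕtoℚ-* (K * suc E) L) (cong (ℚ._* ℕtoℚ L) (ℕtoℚ-* K (suc E)))) ⟩
          ℕtoℚ K ℚ.* ℕtoℚ (suc E) ℚ.* ℕtoℚ L ℚ.* f         ≤⟨ ℚₚ.*-monoʳ-≤-nonNeg f {{ℚ.nonNegative 0≤f}}
            (*-mono-≤ (0≤* (0≤ℕtoℚ K) (0≤ℕtoℚ (suc E))) (ℚₚ.≤-trans (0≤ℕtoℚ L) L≤t)
              (ℚₚ.*-monoˡ-≤-nonNeg (ℕtoℚ K) {{ℕtoℚ-nonNeg K}} E≤s) L≤t) ⟩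
          ℕtoℚ K ℚ.* s ℚ.* t ℚ.* f                         ∎)
        where open ℚₚ.≤-Reasoning

    2^L≤f+4 : ℕtoℚ (2 ^ L) ℚ.≤ f ℚ.+ ℕtoℚ 4
    2^L≤f+4 = begin
      ℕtoℚ (2 ^ L)               ≤⟨ ℕtoℚ-mono-≤ 2^L≤ ⟩
      ℕtoℚ (φ + 3)               ≡⟨ ℕtoℚ-+ φ 3 ⟩
      ℕtoℚ φ ℚ.+ ℕtoℚ 3          ≤⟨ ℚₚ.+-monoˡ-≤ (ℕtoℚ 3) φ≤f+1 ⟩
      f ℚ.+ 1ℚ ℚ.+ ℕtoℚ 3        ≡⟨ ℚₚ.+-assoc f 1ℚ (ℕtoℚ 3) ⟩
      f ℚ.+ ℕtoℚ 4               ∎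
      where open ℚₚ.≤-Reasoning

    open Separator 1≤J small X using (Separation; separator)

    separation⇒result : Separation → Result
    separation⇒result (S , pay , down , covered , cheap , local) = S ,
      clustered⇒balanced S (λ a → Sum.map₂
        (λ (u , u∈X , close) → u , u∈X , λ y y∈X W → close⇒d-small u y u∈X y∈X (close y W)) (local a)) ,
      down ,
      bounded S (y S pay covered cheap) (y-cover S pay covered cheap) (λ p q p′ q′ above above′ →
        y-bound S pay covered cheap (ℤ.+ p ℚ./ suc q) (ℤ.+ p′ ℚ./ suc q′)
          -- From `2 ^ E ≤ n` comes 2^(E+1) ≤ 2n: the factor 2 under the logarithm absorbs the
          -- successor.
          (log2-lower (suc E) _ p q (ℕtoℚ-mono-≤ (ℕₚ.*-monoʳ-≤ 2 2^E≤n)) above)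
          (log2-lower L _ p′ q′ 2^L≤f+4 above′))

    result : Result
    result = separation⇒result separator

  large-value : ¬ (ℕtoℚ 20 ℚ.* f ℚ.≤ 1ℚ) → Result
  large-value 20f≰1 = with-ceiling (ceiling f 0≤f)
    where
    with-logs : ∀ φ → 1 ≤ φ → f ℚ.≤ ℕtoℚ φ → ℕtoℚ φ ℚ.≤ f ℚ.+ 1ℚ →
                ∃[ L ] (2 ^ L ≤ φ + 3 × φ + 3 < 2 ^ suc L) → ∃[ E ] (2 ^ E ≤ n × n < 2 ^ suc E) → Result
    with-logs φ 1≤φ f≤φ φ≤f+1 (L , 2^L≤ , <2^L) (E , 2^E≤n , n<2^E) = at (5 * L) _ _ refl refl refl
      where
      at : ∀ J R Q → J ≡ 5 * L → R ≡ 5 * (J * 2 ^ E) → Q ≡ 20 * R → Result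
      at J R Q J≡ R≡ Q≡ = Large.result 20f≰1 φ 1≤φ f≤φ φ≤f+1 L 2^L≤ <2^L E 2^E≤n n<2^E J R Q J≡ R≡ Q≡
        (λ c → proj₁ (rounded c)) (λ c → proj₁ (proj₂ (proj₂ (rounded c)))) (λ c → proj₂ (proj₂ (proj₂ (rounded c))))
        where
        rounded : ∀ c → ∃[ m ] (1 ≤ m × ℕtoℚ Q ℚ.* x c ℚ.≤ ℕtoℚ m × ℕtoℚ m ℚ.≤ ℕtoℚ Q ℚ.* x c ℚ.+ 1ℚ)
        rounded c = ceiling (ℕtoℚ Q ℚ.* x c) (0≤* (0≤ℕtoℚ Q) (0≤x c))
    with-ceiling : ∃[ φ ] (1 ≤ φ × f ℚ.≤ ℕtoℚ φ × ℕtoℚ φ ℚ.≤ f ℚ.+ 1ℚ) → Result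
    with-ceiling (φ , 1≤φ , f≤φ , φ≤f+1) = with-logs φ 1≤φ f≤φ φ≤f+1
      (floor-log2 (φ + 3) (ℕₚ.≤-trans 1≤φ (ℕₚ.m≤m+n φ 3))) (floor-log2 n (nonempty-index isCenter x 20f≰1))

  rounding : Result
  rounding = [ small-value , large-value ]′ (Dec.toSum (ℕtoℚ 20 ℚ.* f ℚₚ.≤? 1ℚ))

theorem6p1 : (n : ℕ) (G : Graph n) (k : ℕ) → 1 ≤ k →
    (layer : Fin n → ℕ) → (desc : Fin n → Fin n → Bool) →
    (∀ c v → T (desc c v) ⇔ Layered.Desc G layer c v) →
    Layered.WithTable.ThicknessAtMost G layer desc k →
    (X : Subset n) → (∀ v → v ∈ X → T (Layered.isCenter G layer v)) →
    (f : ℚ) → Layered.WithTable.IsLPOpt G layer desc X f →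
    Σ (Subset n) λ S → Layered.BalancedSep G layer X S ×
    Layered.WithTable.DownwardClosed G layer desc S ×
    Σ ℚ λ c → Layered.WithTable.IsFcov G layer desc S c × BoundLE c k n f
theorem6p1 n G k 1≤k layer desc desc⇔ _ X _ _ ((x , d , feasible , refl) , _) =
  LPRounding.rounding G (5000 * k) (ℕₚ.m≤m*n 5000 k {{>-nonZero 1≤k}}) layer desc desc⇔ X x d feasible
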